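{- There is a constant $C>0$ such that the following holds. For every integer $r\ge 3$ and every sufficiently large $n$, there is a balanced $r$-colouring of the edges of $K_n$ such that, for every tree $T$ on $n$ vertices with maximum degree $\Delta\ge 23n/24+C$ and every copy of $T$ in $K_n$, the number of edges in colour $1$ is at most the number of edges in some colour among $2,\dots,r$.
   Context: An $r$-colouring is an edge-colouring with colours in $\{1,\dots,r\}$. It is balanced if the numbers of edges in any two different colours differ by at most $1$. A copy of $T$ in $K_n$ is a subgraph of $K_n$ isomorphic to $T$. "Sufficiently large $n$" may depend on $r$; the constant $C$ does not. -}

module Defs where

open import Data.Nat using (ℕ; _+_; _≤_; ∣_-_∣)
open import Data.Nat.Properties using () renaming (_≟_ to _≟ℕ_)
open import Data.Fin using (Fin; zero; suc; inject₁; fromℕ)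
open import Data.Fin.Properties using (_≟_; _<?_)
open import Data.Fin.Permutation using (Permutation′; _⟨$⟩ʳ_)
open import Data.List using (List; length; map; filter; allFin; cartesianProduct)
open import Data.List.Extrema.Nat using (max)
open import Data.Product using (Σ-syntax; _×_; _,_)
open import Function using (_∘_)
open import Function.Bundles using (_⇔_)
open import Function.Definitions using (Injective)
open import Level using (0ℓ)
open import Relation.Binary.Core using (Rel)
open import Relation.Binary.Definitions using (Symmetric; Irreflexive; Decidable)
open import Relation.Binary.Construct.Closure.ReflexiveTransitive using (Star)
open import Relation.Binary.PropositionalEquality using (_≡_; _≢_; sym)
open import Relation.Nullary using (¬_)
open import Relation.Nullary.Decidable using (¬?; _×-dec_)

record Graph (n : ℕ) : Set₁ where
  field
    Adj        : Rel (Fin n) 0ℓ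
    adj?       : Decidable Adj
    adj-sym    : Symmetric Adj
    adj-irrefl : Irreflexive _≡_ Adj

open Graph public

K : (n : ℕ) → Graph n
K n = record
  { Adj        = _≢_
  ; adj?       = λ u v → ¬? (u ≟ v)
  ; adj-sym    = λ u≢v → u≢v ∘ sym
  ; adj-irrefl = λ u≡v u≢v → u≢v u≡v
  }

-- Each edge {u , v} is listed once, as the pair with u < v.
edges : ∀ {n} → Graph n → List (Fin n × Fin n)
edges {n} G =
  filter (λ (u , v) → (u <? v) ×-dec adj? G u v)
         (cartesianProduct (allFin n) (allFin n))

degree : ∀ {n} → Graph n → Fin n → ℕ
degree {n} G u = length (filter (adj? G u) (allFin n))

maxDegree : ∀ {n} → Graph n → ℕ
maxDegree {n} G = max 0 (map (degree G) (allFin n))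

-- The first component excludes the graph with no vertices.
Connected : ∀ {n} → Graph n → Set
Connected {n} G = Fin n × (∀ u v → Star (Adj G) u v)

record Cycle {n : ℕ} (G : Graph n) : Set where
  field
    k        : ℕ
    vertex   : Fin (3 + k) → Fin n
    distinct : Injective _≡_ _≡_ vertex
    step     : ∀ (i : Fin (2 + k)) → Adj G (vertex (inject₁ i)) (vertex (suc i))
    closing  : Adj G (vertex (fromℕ (2 + k))) (vertex zero)

IsTree : ∀ {n} → Graph n → Set
IsTree G = Connected G × ¬ Cycle G

_≅_ : ∀ {n} → Graph n → Graph n → Set
_≅_ {n} G H =
  Σ[ π ∈ Permutation′ n ] (∀ u v → Adj G u v ⇔ Adj H (π ⟨$⟩ʳ u) (π ⟨$⟩ʳ v))

_⊆_ : ∀ {n} → Graph n → Graph n → Set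
H ⊆ G = ∀ u v → Adj H u v → Adj G u v

-- T has as many vertices as G, so every subgraph of G isomorphic to T is
-- spanning, i.e. again a graph on Fin n.
record Copy {n : ℕ} (T G : Graph n) : Set₁ where
  field
    graph    : Graph n
    subgraph : graph ⊆ G
    iso      : T ≅ graph

-- The values of colour on non-adjacent pairs are irrelevant.
record EdgeColouring {n : ℕ} (G : Graph n) (r : ℕ) : Set where
  field
    colour     : Fin n → Fin n → ℕ
    colour-sym : ∀ u v → Adj G u v → colour u v ≡ colour v u
    in-range   : ∀ u v → Adj G u v → 1 ≤ colour u v × colour u v ≤ r

open EdgeColouring public

-- The number of edges of colour i in H, intended for subgraphs H of G.
colourCount : ∀ {n r} {G : Graph n} → EdgeColouring G r → Graph n → ℕ → ℕ
colourCount c H i =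
  length (filter (λ (u , v) → colour c u v ≟ℕ i) (edges H))

Balanced : ∀ {n r} {G : Graph n} → EdgeColouring G r → Set
Balanced {r = r} {G = G} c =
  ∀ i j → 1 ≤ i → i ≤ r → 1 ≤ j → j ≤ r →
  ∣ colourCount c G i - colourCount c G j ∣ ≤ 1

{-# OPTIONS --safe #-}
module Submission where

-- A vertex of degree n − 1 − y of a spanning tree sees all but y of the edges of K n at that vertex, and only y
-- edges of the tree avoid it. As y ≤ n/24, it is enough that every vertex u has a colour j(u) ≥ 2 in which its
-- degree in K n exceeds its degree in colour 1 by n/12. Split the vertices into r − 1 blocks of consecutive
-- vertices, one for each colour other than 1, and let the edge uv ask for the colour of its smaller endpoint, of
-- its larger endpoint, or for no colour, according to u + v modulo 24r, the last option being taken with frequency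
-- 26/(24r). So u has about n/2 − n/(2r) edges that ask for the colour of u because of u, about n/(2r) more inside
-- its block, and about n/r edges without a demand; the latter absorb colour 1. Each colour is in demand
-- slightly less often than once in r edges, so the remaining edges can be coloured so as to balance everything.

open import Data.Nat using (ℕ; _+_; _*_; _≤_; _<_; _≥_)
open import Data.Product using (Σ-syntax; ∃-syntax; _×_)
open import Defs

open import Data.Fin using (Fin; zero; suc; toℕ; inject₁; fromℕ; fromℕ<)
import Data.Fin.Properties as Fin
open import Data.Fin.Permutation using (_⟨$⟩ʳ_; _⟨$⟩ˡ_; inverseʳ)
open import Data.List using (List; []; _∷_; length; filter; map; allFin; cartesianProduct; tabulate; _++_; lookup)
open import Data.List.Membership.Propositional using (_∈_)
open import Data.List.Membership.Propositional.Properties using (∈-lookup; ∈-map⁻)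
open import Data.List.Relation.Unary.All as All using (All; []; _∷_)
import Data.List.Relation.Unary.All.Properties as All
open import Data.List.Relation.Unary.AllPairs using ([]; _∷_)
open import Data.List.Relation.Unary.Any using (here; there)
open import Data.List.Relation.Unary.Unique.Propositional using (Unique)
import Data.List.Relation.Unary.Unique.Propositional.Properties as Unique
open import Data.Maybe using (Maybe; just; nothing; fromMaybe)
import Data.Maybe.Properties as Maybe
open import Data.Nat using (zero; suc; s≤s; z≤n; z<s; s<s; s<s⁻¹; _∸_; _/_; _%_; _⊓_; _⊔_; ∣_-_∣; _≟_; _<?_; NonZero; >-nonZero⁻¹)
open import Data.Nat.DivMod
open import Data.Nat.Properties hiding (_≟_; _<?_)
open import Algebra.Properties.Semiring.Sum +-*-semiring
  using (sum; sum-cong-≗; ∑-distrib-+; ∑-comm; sum-permute; *-distribˡ-sum; *-distribʳ-sum)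
open import Data.List.Extrema ≤-totalOrder using (argmax-sel)
open import Data.Nat.Tactic.RingSolver using (solve-∀)
open import Data.Product using (_,_; proj₁; proj₂)
open import Data.Product.Properties using (≡-dec)
open import Data.Sum as Sum using (_⊎_; inj₁; inj₂)
open import Function using (_∘_; id)
open import Function.Bundles using (Equivalence)
open import Level using (0ℓ)
open import Relation.Binary.Core using (Rel)
open import Relation.Binary.Definitions using (DecidableEquality; tri<; tri≈; tri>)
open import Relation.Binary.PropositionalEquality
open import Relation.Nullary using (¬_; Dec; yes; no; contradiction)
open import Relation.Nullary.Decidable using (_×-dec_; ¬?)
open import Relation.Unary using (Pred; Decidable)

-- Sums and indicators

-- Two aims conflict: a vertex wants many edges in its own colour, but no colour may be demanded on
-- more than its share 1/r of the edges, or the demands could not be completed to a balanced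
-- colouring. The residue rule replaces a random assignment: it is symmetric in u and v, and as v
-- runs through an interval, u + v runs through consecutive integers, so for every u all residues
-- occur equally often up to one period. Smaller and larger endpoints are favoured by the same
-- number h of residues, so the position of u in the order does not matter. With 24 residues free of
-- demand and h = 12(r - 1), every colour would be demanded on a fraction 1/r of the edges, up to
-- lower order terms. One pair of residues is given up, whence 26 and h = 12(r - 1) - 1. This leaves
-- a quadratic reserve for the linear rounding errors and costs a vertex only about n/(24(r - 1)) of
-- its own degree. The step from n/24 to n/12 is a factor of two: all y tree edges that avoid the
-- vertex may have colour 1, and all y missing edges at it may have its colour j(u).

𝟙 : ∀ {a} {A : Set a} → Dec A → ℕ
𝟙 (yes _) = 1
𝟙 (no _)  = 0

module _ {a b} {A : Set a} {B : Set b} where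

  𝟙-mono : (A → B) → (A? : Dec A) (B? : Dec B) → 𝟙 A? ≤ 𝟙 B?
  𝟙-mono f (no _)  _        = z≤n
  𝟙-mono f (yes _) (yes _)  = ≤-refl
  𝟙-mono f (yes p) (no ¬q)  = contradiction (f p) ¬q

  𝟙-× : (A? : Dec A) (B? : Dec B) → 𝟙 (A? ×-dec B?) ≡ 𝟙 A? * 𝟙 B?
  𝟙-× (no _)  _       = refl
  𝟙-× (yes _) (yes _) = refl
  𝟙-× (yes _) (no _)  = refl

𝟙-cong : ∀ {a b} {A : Set a} {B : Set b} → (A → B) → (B → A) →
         (A? : Dec A) (B? : Dec B) → 𝟙 A? ≡ 𝟙 B?
𝟙-cong f g A? B? = ≤-antisym (𝟙-mono f A? B?) (𝟙-mono g B? A?)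

module _ {a} {A : Set a} where

  𝟙-yes : A → (A? : Dec A) → 𝟙 A? ≡ 1
  𝟙-yes p (yes _) = refl
  𝟙-yes p (no ¬p) = contradiction p ¬p

  𝟙-no : ¬ A → (A? : Dec A) → 𝟙 A? ≡ 0
  𝟙-no ¬p (yes p) = contradiction p ¬p
  𝟙-no ¬p (no _)  = refl

  𝟙≤1 : (A? : Dec A) → 𝟙 A? ≤ 1
  𝟙≤1 (yes _) = ≤-refl
  𝟙≤1 (no _)  = z≤n

sum-mono : ∀ {n} {f g : Fin n → ℕ} → (∀ i → f i ≤ g i) → sum f ≤ sum g
sum-mono {zero}  f≤g = z≤n
sum-mono {suc n} f≤g = +-mono-≤ (f≤g zero) (sum-mono (f≤g ∘ suc))

sum-const : ∀ n c → sum {n} (λ _ → c) ≡ n * c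
sum-const zero    c = refl
sum-const (suc n) c = cong (c +_) (sum-const n c)

sum-≡ : ∀ {n} (k : Fin n) (f : Fin n → ℕ) → sum (λ i → 𝟙 (i Fin.≟ k) * f i) ≡ f k
sum-≡ {suc n} zero f = begin
  1 * f zero + sum {n} (λ _ → 0)  ≡⟨ cong₂ _+_ (*-identityˡ _) (trans (sum-const n 0) (*-zeroʳ n)) ⟩
  f zero + 0                      ≡⟨ +-identityʳ _ ⟩
  f zero                          ∎
  where open ≡-Reasoning
sum-≡ {suc n} (suc k) f = trans
  (sum-cong-≗ λ i → cong (_* f (suc i)) (𝟙-cong Fin.suc-injective (cong suc) (suc i Fin.≟ suc k) (i Fin.≟ k)))
  (sum-≡ k (f ∘ suc))

sum-≡₁ : ∀ {n} (k : Fin n) → sum (λ i → 𝟙 (i Fin.≟ k)) ≡ 1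
sum-≡₁ {n} k = trans (sum-cong-≗ {n} λ i → sym (*-identityʳ _)) (sum-≡ k (λ _ → 1))

term≤sum : ∀ {n} (f : Fin n → ℕ) (k : Fin n) → f k ≤ sum f
term≤sum f zero    = m≤m+n _ _
term≤sum f (suc k) = ≤-trans (term≤sum (f ∘ suc) k) (m≤n+m _ _)

sumₗ : ∀ {a} {A : Set a} → (A → ℕ) → List A → ℕ
sumₗ f []       = 0
sumₗ f (x ∷ xs) = f x + sumₗ f xs

module _ {a} {A : Set a} where

  sumₗ-cong : {f g : A → ℕ} → (∀ x → f x ≡ g x) → ∀ xs → sumₗ f xs ≡ sumₗ g xs
  sumₗ-cong f≡g []       = refl
  sumₗ-cong f≡g (x ∷ xs) = cong₂ _+_ (f≡g x) (sumₗ-cong f≡g xs)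

  sumₗ-++ : (f : A → ℕ) → ∀ xs ys → sumₗ f (xs ++ ys) ≡ sumₗ f xs + sumₗ f ys
  sumₗ-++ f []       ys = refl
  sumₗ-++ f (x ∷ xs) ys = trans (cong (f x +_) (sumₗ-++ f xs ys)) (sym (+-assoc (f x) _ _))

  sumₗ-map : ∀ {b} {B : Set b} (f : B → ℕ) (g : A → B) → ∀ xs → sumₗ f (map g xs) ≡ sumₗ (f ∘ g) xs
  sumₗ-map f g []       = refl
  sumₗ-map f g (x ∷ xs) = cong (f (g x) +_) (sumₗ-map f g xs)

  sumₗ-tabulate : (f : A → ℕ) → ∀ {n} (g : Fin n → A) → sumₗ f (tabulate g) ≡ sum (f ∘ g)
  sumₗ-tabulate f {zero}  g = refl
  sumₗ-tabulate f {suc n} g = cong (f (g zero) +_) (sumₗ-tabulate f (g ∘ suc))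

  length-filter : ∀ {p} {P : Pred A p} (P? : Decidable P) → ∀ xs → length (filter P? xs) ≡ sumₗ (𝟙 ∘ P?) xs
  length-filter P? []       = refl
  length-filter P? (x ∷ xs) with P? x
  ... | yes _ = cong suc (length-filter P? xs)
  ... | no _  = length-filter P? xs

  sumₗ-filter : ∀ {p} {P : Pred A p} (P? : Decidable P) (f : A → ℕ) → ∀ xs →
                sumₗ f (filter P? xs) ≡ sumₗ (λ x → 𝟙 (P? x) * f x) xs
  sumₗ-filter P? f []       = refl
  sumₗ-filter P? f (x ∷ xs) with P? x
  ... | yes _ = cong₂ _+_ (sym (*-identityˡ (f x))) (sumₗ-filter P? f xs)
  ... | no _  = sumₗ-filter P? f xs

sumₗ-cartesianProduct : ∀ {a b} {A : Set a} {B : Set b} (f : A × B → ℕ) (xs : List A) (ys : List B) →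
                        sumₗ f (cartesianProduct xs ys) ≡ sumₗ (λ x → sumₗ (λ y → f (x , y)) ys) xs
sumₗ-cartesianProduct f []       ys = refl
sumₗ-cartesianProduct f (x ∷ xs) ys = trans (sumₗ-++ f (map (x ,_) ys) _)
  (cong₂ _+_ (sumₗ-map f (x ,_) ys) (sumₗ-cartesianProduct f xs ys))

sumₗ-allPairs : ∀ n (f : Fin n × Fin n → ℕ) →
                sumₗ f (cartesianProduct (allFin n) (allFin n)) ≡ sum (λ u → sum (λ v → f (u , v)))
sumₗ-allPairs n f = begin
  sumₗ f (cartesianProduct (allFin n) (allFin n))           ≡⟨ sumₗ-cartesianProduct f (allFin n) (allFin n) ⟩
  sumₗ (λ u → sumₗ (λ v → f (u , v)) (allFin n)) (allFin n) ≡⟨ sumₗ-tabulate _ {n} id ⟩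
  sum (λ u → sumₗ (λ v → f (u , v)) (allFin n))             ≡⟨ sum-cong-≗ {n} (λ u → sumₗ-tabulate _ {n} id) ⟩
  sum (λ u → sum (λ v → f (u , v)))                         ∎
  where open ≡-Reasoning

-- Extending a partial colouring to a balanced one

sum-toℕ< : ∀ r k → k ≤ r → sum {r} (λ j → 𝟙 (toℕ j <? k)) ≡ k
sum-toℕ< zero    zero    _         = refl
sum-toℕ< (suc r) zero    _         = sum-toℕ< r 0 z≤n
sum-toℕ< (suc r) (suc k) (s≤s k≤r) = cong suc (trans
  (sum-cong-≗ {r} λ j → 𝟙-cong s<s⁻¹ s<s (suc (toℕ j) <? suc k) (toℕ j <? k))
  (sum-toℕ< r k k≤r))

-- The first `M % r` parts get the extra unit. Demands are compared with the lower bound; the two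
-- bounds together give balance.
balancedParts : ∀ M r .{{_ : NonZero r}} →
                Σ[ t ∈ (Fin r → ℕ) ] (sum t ≡ M × (∀ j → M / r ≤ t j × t j ≤ suc (M / r)))
balancedParts M r = t , sum-t , λ j → m≤m+n _ _ ,
    ≤-trans (+-monoʳ-≤ (M / r) (𝟙≤1 (toℕ j <? M % r))) (≤-reflexive (+-comm (M / r) 1))
  where
  open ≡-Reasoning
  t : Fin r → ℕ
  t j = M / r + 𝟙 (toℕ j <? M % r)
  sum-t : sum t ≡ M
  sum-t = begin
    sum t                                                          ≡⟨ ∑-distrib-+ {r} _ _ ⟩
    sum {r} (λ _ → M / r) + sum {r} (λ j → 𝟙 (toℕ j <? M % r))  ≡⟨ cong₂ _+_ (sum-const r (M / r)) (sum-toℕ< r (M % r) (<⇒≤ (m%n<n M r))) ⟩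
    r * (M / r) + M % r                                            ≡⟨ cong (_+ M % r) (*-comm r (M / r)) ⟩
    M / r * r + M % r                                              ≡⟨ +-comm _ (M % r) ⟩
    M % r + M / r * r                                              ≡⟨ sym (m≡m%n+[m/n]*n M r) ⟩
    M                                                              ∎

sum-mono-< : ∀ {n} {f g : Fin n → ℕ} → sum f < sum g → ∃[ i ] f i < g i
sum-mono-< {n} {f} {g} f<g with Fin.any? (λ i → f i <? g i)
... | yes p = p
... | no ¬p = contradiction (sum-mono {n} (λ i → ≮⇒≥ (λ fi<gi → ¬p (i , fi<gi)))) (<⇒≱ f<g)

remove-one : ∀ {r} (t : Fin r → ℕ) j → 0 < t j →
             Σ[ t′ ∈ (Fin r → ℕ) ] ((∀ k → 𝟙 (j Fin.≟ k) + t′ k ≡ t k) × suc (sum t′) ≡ sum t)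
remove-one {r} t j 0<tj = t′ , t-eq , trans (cong (_+ sum t′) (sym sum-δ)) (trans (sym (∑-distrib-+ {r} _ _)) (sum-cong-≗ t-eq))
  where
  t′ : Fin r → ℕ
  t′ k = t k ∸ 𝟙 (j Fin.≟ k)
  sum-δ : sum (λ k → 𝟙 (j Fin.≟ k)) ≡ 1
  sum-δ = trans (sum-cong-≗ {r} λ k → 𝟙-cong sym sym (j Fin.≟ k) (k Fin.≟ j)) (sum-≡₁ j)
  t-eq : ∀ k → 𝟙 (j Fin.≟ k) + t′ k ≡ t k
  t-eq k with j Fin.≟ k
  ... | yes refl = m+[n∸m]≡n 0<tj
  ... | no _     = refl

module Extension {a} {A : Set a} (_≟_ : DecidableEquality A) {r : ℕ} where

  update : A → Fin (suc r) → (A → Fin (suc r)) → A → Fin (suc r)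
  update x j f y with y ≟ x
  ... | yes _ = j
  ... | no _  = f y

  update-≡ : ∀ x j f → update x j f x ≡ j
  update-≡ x j f with x ≟ x
  ... | yes _  = refl
  ... | no x≢x = contradiction refl x≢x

  update-≢ : ∀ x j f {y} → x ≢ y → update x j f y ≡ f y
  update-≢ x j f {y} x≢y with y ≟ x
  ... | yes y≡x = contradiction (sym y≡x) x≢y
  ... | no _    = refl

  used : (A → Fin (suc r)) → Fin (suc r) → List A → ℕ
  used f k = sumₗ (λ x → 𝟙 (f x Fin.≟ k))

  _≟ₘ_ : DecidableEquality (Maybe (Fin (suc r)))
  _≟ₘ_ = Maybe.≡-dec Fin._≟_

  demand : (A → Maybe (Fin (suc r))) → Fin (suc r) → List A → ℕ
  demand p k = sumₗ (λ x → 𝟙 (p x ≟ₘ just k))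

  used-update : ∀ {x j f k xs} → All (x ≢_) xs → used (update x j f) k xs ≡ used f k xs
  used-update []                                = refl
  used-update {x} {j} {f} {k} (x≢y ∷ x∉xs) =
    cong₂ _+_ (cong (λ i → 𝟙 (i Fin.≟ k)) (update-≢ x j f x≢y)) (used-update x∉xs)

  module _ (p : A → Maybe (Fin (suc r))) where

    Extends : (A → Fin (suc r)) → Set a
    Extends f = ∀ x j → p x ≡ just j → f x ≡ j

    sum-demand : ∀ xs → sum (λ k → demand p k xs) ≤ length xs
    sum-demand []       = ≤-reflexive (trans (sum-const (suc r) 0) (*-zeroʳ (suc r)))
    sum-demand (x ∷ xs) = ≤-trans (≤-reflexive (∑-distrib-+ {suc r} (λ k → 𝟙 (p x ≟ₘ just k)) (λ k → demand p k xs))) (+-mono-≤ head≤1 (sum-demand xs))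
      where
      head≤1 : sum (λ k → 𝟙 (p x ≟ₘ just k)) ≤ 1
      head≤1 with p x
      ... | nothing = ≤-trans (≤-reflexive (trans (sum-const (suc r) 0) (*-zeroʳ (suc r)))) z≤n
      ... | just j  = ≤-reflexive (trans
        (sum-cong-≗ {suc r} λ k → 𝟙-cong (sym ∘ Maybe.just-injective) (cong just ∘ sym) (just j ≟ₘ just k) (k Fin.≟ j))
        (sum-≡₁ j))

    -- Without a demand at `x`, the rest of the list makes at most `length xs` demands while the
    -- targets add up to one more, so by pigeonhole some colour can be spent on `x`.
    choose : ∀ x xs (t : Fin (suc r) → ℕ) → sum t ≡ suc (length xs) →
             (∀ k → demand p k (x ∷ xs) ≤ t k) →
             ∃[ j ] ((∀ i → p x ≡ just i → j ≡ i) × (∀ k → 𝟙 (j Fin.≟ k) + demand p k xs ≤ t k))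
    choose x xs t sum-t fits with p x
    ... | just j  = j , (λ _ → Maybe.just-injective) , λ k → ≤-trans
      (+-monoˡ-≤ _ (𝟙-mono (cong just) (j Fin.≟ k) (just j ≟ₘ just k))) (fits k)
    ... | nothing with sum-mono-< {suc r} {λ k → demand p k xs} {t}
                         (≤-trans (s≤s (sum-demand xs)) (≤-reflexive (sym sum-t)))
    ...   | j , free = j , (λ _ ()) , bound
      where
      bound : ∀ k → 𝟙 (j Fin.≟ k) + demand p k xs ≤ t k
      bound k with j Fin.≟ k
      ... | yes refl = free
      ... | no _     = fits k

    -- Greedy choice along the list. The invariant: the targets add up to the number of elements
    -- still to be coloured and dominate the demands still to come. Uniqueness keeps the choice at
    -- `x` from disturbing the counts on `xs`.
    extend : ∀ xs → Unique xs → (t : Fin (suc r) → ℕ) → sum t ≡ length xs →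
             (∀ k → demand p k xs ≤ t k) →
             Σ[ f ∈ (A → Fin (suc r)) ] (Extends f × (∀ k → used f k xs ≡ t k))
    extend [] _ t sum-t _ =
      -- `Extends` also speaks of elements outside the list, so the initial function must obey `p`
      -- already; the default `zero` survives only outside the list.
      (λ x → fromMaybe zero (p x)) , (λ x j px≡j → cong (fromMaybe zero) px≡j) ,
      λ k → sym (n≤0⇒n≡0 (≤-trans (term≤sum t k) (≤-reflexive sum-t)))
    extend (x ∷ xs) (x∉xs ∷ uniq) t sum-t fits
      with choose x xs t sum-t fits
    ... | j , agrees , fits′
      with remove-one t j (≤-trans (s≤s z≤n) (≤-trans
             (≤-reflexive (cong (_+ demand p j xs) (sym (𝟙-yes refl (j Fin.≟ j))))) (fits′ j)))
    ... | t′ , t-eq , sum-t′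
      with extend xs uniq t′ (suc-injective (trans sum-t′ sum-t))
             (λ k → +-cancelˡ-≤ (𝟙 (j Fin.≟ k)) _ _ (≤-trans (fits′ k) (≤-reflexive (sym (t-eq k)))))
    ... | f , extends , used-f = update x j f , extends′ , λ k → trans
            (cong₂ _+_ (cong (λ i → 𝟙 (i Fin.≟ k)) (update-≡ x j f)) (trans (used-update x∉xs) (used-f k)))
            (t-eq k)
      where
      extends′ : Extends (update x j f)
      extends′ y i py≡i with y ≟ x
      ... | yes refl = agrees i py≡i
      ... | no _     = extends y i py≡i

-- Sums over initial segments and periodic sequences

-- Summands are indexed by ℕ, so that ranges can be split and shifted without casts between `Fin`
-- types.
sum< : ℕ → (ℕ → ℕ) → ℕ
sum< zero    f = 0
sum< (suc n) f = f 0 + sum< n (f ∘ suc)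

sum-toℕ : ∀ n f → sum {n} (f ∘ toℕ) ≡ sum< n f
sum-toℕ zero    f = refl
sum-toℕ (suc n) f = cong (f 0 +_) (sum-toℕ n (f ∘ suc))

sum<-cong : ∀ n {f g} → (∀ i → i < n → f i ≡ g i) → sum< n f ≡ sum< n g
sum<-cong zero    f≡g = refl
sum<-cong (suc n) f≡g = cong₂ _+_ (f≡g 0 z<s) (sum<-cong n (λ i i<n → f≡g (suc i) (s<s i<n)))

sum<-mono : ∀ n {f g} → (∀ i → i < n → f i ≤ g i) → sum< n f ≤ sum< n g
sum<-mono zero    f≤g = z≤n
sum<-mono (suc n) f≤g = +-mono-≤ (f≤g 0 z<s) (sum<-mono n (λ i i<n → f≤g (suc i) (s<s i<n)))

sum<-const : ∀ n c → sum< n (λ _ → c) ≡ n * c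
sum<-const zero    c = refl
sum<-const (suc n) c = cong (c +_) (sum<-const n c)

sum<-distrib-+ : ∀ n f g → sum< n (λ i → f i + g i) ≡ sum< n f + sum< n g
sum<-distrib-+ n f g = begin
  sum< n (λ i → f i + g i)                     ≡⟨ sum-toℕ n (λ i → f i + g i) ⟨
  sum {n} (λ i → f (toℕ i) + g (toℕ i))        ≡⟨ ∑-distrib-+ {n} (f ∘ toℕ) (g ∘ toℕ) ⟩
  sum {n} (f ∘ toℕ) + sum {n} (g ∘ toℕ)        ≡⟨ cong₂ _+_ (sum-toℕ n f) (sum-toℕ n g) ⟩
  sum< n f + sum< n g                          ∎
  where open ≡-Reasoning

sum<-+ : ∀ m n f → sum< (m + n) f ≡ sum< m f + sum< n (λ i → f (m + i))
sum<-+ zero    n f = refl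
sum<-+ (suc m) n f = trans (cong (f 0 +_) (sum<-+ m n (f ∘ suc))) (sym (+-assoc (f 0) _ _))

sum<-snoc : ∀ n f → sum< (suc n) f ≡ sum< n f + f n
sum<-snoc n f = begin
  sum< (suc n) f                          ≡⟨ cong (λ m → sum< m f) (+-comm 1 n) ⟩
  sum< (n + 1) f                          ≡⟨ sum<-+ n 1 f ⟩
  sum< n f + (f (n + 0) + 0)              ≡⟨ cong (sum< n f +_) (trans (+-identityʳ _) (cong f (+-identityʳ n))) ⟩
  sum< n f + f n                          ∎
  where open ≡-Reasoning

sum<-weakenˡ : ∀ {m n} f → m ≤ n → sum< m f ≤ sum< n f
sum<-weakenˡ {m} {n} f m≤n = begin
  sum< m f                                        ≤⟨ m≤m+n _ _ ⟩
  sum< m f + sum< (n ∸ m) (λ i → f (m + i))       ≡⟨ sum<-+ m (n ∸ m) f ⟨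
  sum< (m + (n ∸ m)) f                            ≡⟨ cong (λ k → sum< k f) (m+[n∸m]≡n m≤n) ⟩
  sum< n f                                        ∎
  where open ≤-Reasoning

sum<-zero : ∀ n {f} → (∀ i → i < n → f i ≡ 0) → sum< n f ≡ 0
sum<-zero n f≡0 = trans (sum<-cong n f≡0) (trans (sum<-const n 0) (*-zeroʳ n))

module _ {n u : ℕ} (u≤n : u ≤ n) (f : ℕ → ℕ) where
  open ≤-Reasoning

  private
    split : ∀ g → sum< n g ≡ sum< u g + sum< (n ∸ u) (λ i → g (u + i))
    split g = trans (cong (λ k → sum< k g) (sym (m+[n∸m]≡n u≤n))) (sum<-+ u (n ∸ u) g)

  sum<-below : sum< n (λ v → 𝟙 (v <? u) * f v) ≤ sum< u f
  sum<-below = begin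
    sum< n (λ v → 𝟙 (v <? u) * f v)         ≡⟨ split _ ⟩
    sum< u (λ v → 𝟙 (v <? u) * f v) + sum< (n ∸ u) (λ i → 𝟙 (u + i <? u) * f (u + i))
      ≡⟨ cong (sum< u (λ v → 𝟙 (v <? u) * f v) +_) (sum<-zero (n ∸ u) (λ i _ →
           cong (_* f (u + i)) (𝟙-no (m+n≮m u i) (u + i <? u)))) ⟩
    sum< u (λ v → 𝟙 (v <? u) * f v) + 0     ≡⟨ +-identityʳ _ ⟩
    sum< u (λ v → 𝟙 (v <? u) * f v)
      ≤⟨ sum<-mono u (λ v v<u → ≤-trans (*-monoˡ-≤ (f v) (𝟙≤1 (v <? u))) (≤-reflexive (*-identityˡ (f v)))) ⟩
    sum< u f                                 ∎

  sum<-above : sum< n (λ v → 𝟙 (u <? v) * f v) ≤ sum< (n ∸ u) (λ i → f (u + i))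
  sum<-above = begin
    sum< n (λ v → 𝟙 (u <? v) * f v)         ≡⟨ split _ ⟩
    sum< u (λ v → 𝟙 (u <? v) * f v) + sum< (n ∸ u) (λ i → 𝟙 (u <? u + i) * f (u + i))
      ≡⟨ cong (_+ sum< (n ∸ u) (λ i → 𝟙 (u <? u + i) * f (u + i))) (sum<-zero u (λ v v<u →
           cong (_* f v) (𝟙-no (<-asym v<u) (u <? v)))) ⟩
    sum< (n ∸ u) (λ i → 𝟙 (u <? u + i) * f (u + i))
      ≤⟨ sum<-mono (n ∸ u) (λ i _ → ≤-trans (*-monoˡ-≤ (f (u + i)) (𝟙≤1 (u <? u + i))) (≤-reflexive (*-identityˡ (f (u + i))))) ⟩
    sum< (n ∸ u) (λ i → f (u + i))           ∎

module Periodic (L : ℕ) .{{_ : NonZero L}} (f : ℕ → ℕ) (periodic : ∀ x → f (x + L) ≡ f x) where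

  private κ = sum< L f

  -- Sliding the window by one exchanges `f x` for `f (x + L)`, which is the same number.
  sum-window : ∀ x → sum< L (λ i → f (x + i)) ≡ κ
  sum-window zero    = refl
  sum-window (suc x) = +-cancelˡ-≡ (f x) _ _ (begin
    f x + sum< L (λ i → f (suc x + i))           ≡⟨ cong₂ _+_ (cong f (sym (+-identityʳ x))) (sum<-cong L (λ i _ → cong f (sym (+-suc x i)))) ⟩
    sum< (suc L) (λ i → f (x + i))               ≡⟨ sum<-snoc L (λ i → f (x + i)) ⟩
    sum< L (λ i → f (x + i)) + f (x + L)         ≡⟨ cong₂ _+_ (sum-window x) (periodic x) ⟩
    κ + f x                                      ≡⟨ +-comm κ (f x) ⟩
    f x + κ                                      ∎)
    where open ≡-Reasoning

  sum-windows : ∀ q x → sum< (q * L) (λ i → f (x + i)) ≡ q * κ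
  sum-windows zero    x = refl
  sum-windows (suc q) x = begin
    sum< (L + q * L) (λ i → f (x + i))                                   ≡⟨ sum<-+ L (q * L) _ ⟩
    sum< L (λ i → f (x + i)) + sum< (q * L) (λ i → f (x + (L + i)))      ≡⟨ cong₂ _+_ (sum-window x) (sum<-cong (q * L) (λ i _ → cong f (sym (+-assoc x L i)))) ⟩
    κ + sum< (q * L) (λ i → f (x + L + i))                               ≡⟨ cong (κ +_) (sum-windows q (x + L)) ⟩
    κ + q * κ                                                            ∎
    where open ≡-Reasoning

  private
    decompose : ∀ N x → sum< N (λ i → f (x + i)) ≡ N / L * κ + sum< (N % L) (λ i → f (x + (N / L * L + i)))
    decompose N x = begin
      sum< N (λ i → f (x + i))                                     ≡⟨ cong (λ k → sum< k (λ i → f (x + i))) (trans (m≡m%n+[m/n]*n N L) (+-comm (N % L) _)) ⟩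
      sum< (N / L * L + N % L) (λ i → f (x + i))                   ≡⟨ sum<-+ (N / L * L) (N % L) _ ⟩
      sum< (N / L * L) (λ i → f (x + i)) + sum< (N % L) (λ i → f (x + (N / L * L + i)))
                                                                   ≡⟨ cong (_+ sum< (N % L) (λ i → f (x + (N / L * L + i)))) (sum-windows (N / L) x) ⟩
      N / L * κ + sum< (N % L) (λ i → f (x + (N / L * L + i)))     ∎
      where open ≡-Reasoning

  -- The incomplete last period is completed at a cost of at most `κ`; in `sum-lower` it is dropped
  -- instead. The factor `L` keeps quotients out of both bounds.
  sum-upper : ∀ N x → L * sum< N (λ i → f (x + i)) ≤ κ * (N + L)
  sum-upper N x = begin
    L * sum< N (λ i → f (x + i))                       ≡⟨ cong (L *_) (decompose N x) ⟩
    L * (N / L * κ + sum< (N % L) (λ i → f (x + (N / L * L + i))))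
      ≤⟨ *-monoʳ-≤ L (+-monoʳ-≤ (N / L * κ) (≤-trans (sum<-weakenˡ _ (<⇒≤ (m%n<n N L)))
           (≤-reflexive (trans (sum<-cong L (λ i _ → cong f (sym (+-assoc x _ i)))) (sum-window (x + N / L * L)))))) ⟩
    L * (N / L * κ + κ)                                ≡⟨ lemma L (N / L) κ ⟩
    κ * (N / L * L + L)                                ≤⟨ *-monoʳ-≤ κ (+-monoˡ-≤ L (m/n*n≤m N L)) ⟩
    κ * (N + L)                                        ∎
    where
    open ≤-Reasoning
    lemma : ∀ L q κ → L * (q * κ + κ) ≡ κ * (q * L + L)
    lemma = solve-∀

  sum-lower : ∀ N x → κ * N ≤ L * (sum< N (λ i → f (x + i)) + κ)
  sum-lower N x = begin
    κ * N                                        ≡⟨ cong (κ *_) (m≡m%n+[m/n]*n N L) ⟩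
    κ * (N % L + N / L * L)                      ≤⟨ *-monoʳ-≤ κ (+-monoˡ-≤ _ (<⇒≤ (m%n<n N L))) ⟩
    κ * (L + N / L * L)                          ≡⟨ lemma L (N / L) κ ⟩
    L * (N / L * κ + κ)                          ≤⟨ *-monoʳ-≤ L (+-monoˡ-≤ κ (≤-trans (m≤m+n _ _) (≤-reflexive (sym (decompose N x))))) ⟩
    L * (sum< N (λ i → f (x + i)) + κ)           ∎
    where
    open ≤-Reasoning
    lemma : ∀ L q κ → κ * (L + q * L) ≡ L * (q * κ + κ)
    lemma = solve-∀

-- Kinds of edges and their frequencies

data Kind : Set where
  first second spare : Kind

-- Peeling off one pair of residues per step lets frequencies be computed by induction on `h`,
-- without evaluating a concrete period.
kindOfResidue : ℕ → ℕ → Kind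
kindOfResidue zero    _             = spare
kindOfResidue (suc h) zero          = first
kindOfResidue (suc h) (suc zero)    = second
kindOfResidue (suc h) (suc (suc s)) = kindOfResidue h s

isFirst isSecond isSpare isOwned : Kind → ℕ
isFirst first  = 1
isFirst second = 0
isFirst spare  = 0
isSecond first  = 0
isSecond second = 1
isSecond spare  = 0
isSpare first  = 0
isSpare second = 0
isSpare spare  = 1
isOwned first  = 1
isOwned second = 1
isOwned spare  = 0

-- With 26 in front this is a successor for every `h`, as `%` requires. For h = 12(r - 1) - 1 it
-- equals 24r.
period : ℕ → ℕ
period h = 26 + h * 2

kind : ℕ → ℕ → Kind
kind h x = kindOfResidue h (x % period h)

-- The length is `h * 2 + 26` rather than `period h`, so that `suc h` exposes the two successors
-- consumed by `kindOfResidue`.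
sum-kindOfResidue : ∀ (w : Kind → ℕ) h → sum< (h * 2 + 26) (w ∘ kindOfResidue h) ≡ h * (w first + w second) + 26 * w spare
sum-kindOfResidue w zero    = sum<-const 26 (w spare)
sum-kindOfResidue w (suc h) = trans
  (cong (λ s → w first + (w second + s)) (sum-kindOfResidue w h))
  (lemma (w first) (w second) (h * (w first + w second)) (26 * w spare))
  where
  lemma : ∀ a b c d → a + (b + (c + d)) ≡ a + b + c + d
  lemma = solve-∀

sum-kind : ∀ (w : Kind → ℕ) h → sum< (period h) (w ∘ kind h) ≡ h * (w first + w second) + 26 * w spare
sum-kind w h = begin
  sum< (period h) (w ∘ kind h)              ≡⟨ sum<-cong (period h) (λ i i<L → cong (w ∘ kindOfResidue h) (m<n⇒m%n≡m i<L)) ⟩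
  sum< (26 + h * 2) (w ∘ kindOfResidue h)   ≡⟨ cong (λ k → sum< k (w ∘ kindOfResidue h)) (+-comm 26 (h * 2)) ⟩
  sum< (h * 2 + 26) (w ∘ kindOfResidue h)   ≡⟨ sum-kindOfResidue w h ⟩
  h * (w first + w second) + 26 * w spare   ∎
  where open ≡-Reasoning

module KindSums (h : ℕ) (w : Kind → ℕ) (κ : ℕ) (κ-eq : h * (w first + w second) + 26 * w spare ≡ κ) where

  private
    module Per = Periodic (period h) (w ∘ kind h) (λ x → cong (w ∘ kindOfResidue h) ([m+n]%n≡m%n x (period h)))
    total : sum< (period h) (w ∘ kind h) ≡ κ
    total = trans (sum-kind w h) κ-eq

  upper : ∀ N x → period h * sum< N (λ i → w (kind h (x + i))) ≤ κ * (N + period h)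
  upper N x = subst (λ k → period h * sum< N (λ i → w (kind h (x + i))) ≤ k * (N + period h)) total (Per.sum-upper N x)

  lower : ∀ N x → κ * N ≤ period h * (sum< N (λ i → w (kind h (x + i))) + κ)
  lower N x = subst (λ k → k * N ≤ period h * (sum< N (λ i → w (kind h (x + i))) + k)) total (Per.sum-lower N x)

-- Blocks of vertices and preferred colours

module _ (b : ℕ) where

  -- The last block takes all vertices that remain, so it alone may be longer than `b`, by the
  -- remainder of the division into blocks.
  block : ∀ t → ℕ → Fin (suc t)
  block zero    u = zero
  block (suc t) u with u <? b
  ... | yes _ = zero
  ... | no _  = suc (block t (u ∸ b))

  block-< : ∀ t {u} → u < b → block (suc t) u ≡ zero
  block-< t {u} u<b with u <? b
  ... | yes _  = refl
  ... | no u≮b = contradiction u<b u≮b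

  block-+ : ∀ t u → block (suc t) (b + u) ≡ suc (block t u)
  block-+ t u with b + u <? b
  ... | yes p = contradiction p (m+n≮m b u)
  ... | no _  = cong (suc ∘ block t) (m+n∸m≡n b u)

  block-start : ∀ t u → toℕ (block t u) * b ≤ u
  block-start zero    u = z≤n
  block-start (suc t) u with u <? b
  ... | yes _  = z≤n
  ... | no u≮b = ≤-trans (+-monoʳ-≤ b (block-start t (u ∸ b))) (≤-reflexive (m+[n∸m]≡n (≮⇒≥ u≮b)))

  block-inside : ∀ t (c : Fin (suc t)) {v} → toℕ c * b ≤ v → v < toℕ c * b + b → block t v ≡ c
  block-inside zero    zero    _  _ = refl
  block-inside (suc t) zero    _  v<b = block-< t v<b
  block-inside (suc t) (suc c) {v} lo≤v v<hi with m≤n⇒∃[o]m+o≡n (≤-trans (m≤m+n b (toℕ c * b)) lo≤v)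
  ... | o , refl = trans (block-+ t o) (cong suc (block-inside t c
    (+-cancelˡ-≤ b _ _ lo≤v)
    (+-cancelˡ-< b _ _ (≤-trans v<hi (≤-reflexive (+-assoc b _ b))))))

  -- Needed beside `block-inside` because `u` and `v` may lie beyond the first `b` vertices of the
  -- last block.
  block-convex : ∀ t {u v} → toℕ (block t u) * b ≤ v → v ≤ u → block t v ≡ block t u
  block-convex zero    _    _   = refl
  block-convex (suc t) {u} {v} lo≤v v≤u with u <? b
  ... | yes u<b = block-< t (≤-<-trans v≤u u<b)
  ... | no u≮b with m≤n⇒∃[o]m+o≡n (≤-trans (m≤m+n b (toℕ (block t (u ∸ b)) * b)) lo≤v)
  ...   | o , refl = trans (block-+ t o) (cong suc (block-convex t
    (+-cancelˡ-≤ b _ _ lo≤v)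
    (≤-trans (≤-reflexive (sym (m+n∸m≡n b o))) (∸-monoˡ-≤ b v≤u))))

  block-size : ∀ t e n (c : Fin (suc t)) → n ≤ suc t * b + e →
               sum< n (λ u → 𝟙 (block t u Fin.≟ c)) ≤ b + e
  block-size zero e n c n≤ = begin
    sum< n (λ u → 𝟙 (zero Fin.≟ c))  ≤⟨ sum<-mono n (λ _ _ → 𝟙≤1 (zero Fin.≟ c)) ⟩
    sum< n (λ _ → 1)                 ≡⟨ trans (sum<-const n 1) (*-identityʳ n) ⟩
    n                                ≤⟨ n≤ ⟩
    1 * b + e                        ≡⟨ cong (_+ e) (*-identityˡ b) ⟩
    b + e                            ∎
    where open ≤-Reasoning
  block-size (suc t) e n c n≤ with ≤-total n b
  ... | inj₁ n≤b = begin
    sum< n (λ u → 𝟙 (block (suc t) u Fin.≟ c))  ≤⟨ sum<-mono n (λ u _ → 𝟙≤1 (block (suc t) u Fin.≟ c)) ⟩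
    sum< n (λ _ → 1)                            ≡⟨ trans (sum<-const n 1) (*-identityʳ n) ⟩
    n                                           ≤⟨ ≤-trans n≤b (m≤m+n b e) ⟩
    b + e                                       ∎
    where open ≤-Reasoning
  ... | inj₂ b≤n with m≤n⇒∃[o]m+o≡n b≤n
  ...   | m , refl = begin
    sum< (b + m) χ                                             ≡⟨ sum<-+ b m χ ⟩
    sum< b χ + sum< m (λ u → χ (b + u))                        ≡⟨ cong₂ _+_
      (sum<-cong b (λ u u<b → cong (λ i → 𝟙 (i Fin.≟ c)) (block-< t u<b)))
      (sum<-cong m (λ u _ → cong (λ i → 𝟙 (i Fin.≟ c)) (block-+ t u))) ⟩
    sum< b (λ _ → 𝟙 (zero Fin.≟ c)) + sum< m (λ u → 𝟙 (suc (block t u) Fin.≟ c))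
                                                               ≤⟨ cases c ⟩
    b + e                                                      ∎
    where
    open ≤-Reasoning
    χ = λ u → 𝟙 (block (suc t) u Fin.≟ c)
    m≤ : m ≤ suc t * b + e
    m≤ = +-cancelˡ-≤ b _ _ (≤-trans n≤ (≤-reflexive (+-assoc b _ e)))
    cases : ∀ c → sum< b (λ _ → 𝟙 (zero Fin.≟ c)) + sum< m (λ u → 𝟙 (suc (block t u) Fin.≟ c)) ≤ b + e
    cases zero    = +-mono-≤ (≤-reflexive (trans (sum<-const b 1) (*-identityʳ b)))
                             (≤-trans (≤-reflexive (sum<-zero m (λ _ _ → refl))) z≤n)
    cases (suc c) = +-mono-≤ {y = 0} (≤-reflexive (sum<-zero b (λ _ _ → refl)))
                      (≤-trans (sum<-mono m (λ u _ → 𝟙-mono Fin.suc-injective (suc (block t u) Fin.≟ suc c) (block t u Fin.≟ c)))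
                               (block-size t e m c m≤))

module Wish (h b t : ℕ) where

  -- Colour 1 is `zero` here, and block `c` owns the colour `suc c`. With `⊓` and `⊔` the demand
  -- depends only on the unordered pair.
  owner : Kind → ℕ → ℕ → Maybe (Fin (2 + t))
  owner first  u v = just (suc (block b t (u ⊓ v)))
  owner second u v = just (suc (block b t (u ⊔ v)))
  owner spare  u v = nothing

  wish : ℕ → ℕ → Maybe (Fin (2 + t))
  wish u v = owner (kind h (u + v)) u v

  wish-comm : ∀ u v → wish u v ≡ wish v u
  wish-comm u v rewrite +-comm u v with kind h (v + u)
  ... | first  = cong (just ∘ suc ∘ block b t) (⊓-comm u v)
  ... | second = cong (just ∘ suc ∘ block b t) (⊔-comm u v)
  ... | spare  = refl

  _≟ₘ_ : (x y : Maybe (Fin (2 + t))) → Dec (x ≡ y)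
  _≟ₘ_ = Maybe.≡-dec Fin._≟_

  wish≢zero : ∀ u v → wish u v ≢ just zero
  wish≢zero u v with kind h (u + v)
  ... | first  = λ ()
  ... | second = λ ()
  ... | spare  = λ ()

  -- A demand is charged to the endpoint that decides it: the smaller one for `first`, the larger
  -- one for `second`.
  charge : ∀ u v c → u < v →
           𝟙 (wish u v ≟ₘ just (suc c)) ≤
           𝟙 (block b t u Fin.≟ c) * isFirst (kind h (u + v)) + 𝟙 (block b t v Fin.≟ c) * isSecond (kind h (u + v))
  charge u v c u<v with kind h (u + v)
  ... | first  = ≤-trans
    (𝟙-mono (λ eq → trans (cong (block b t) (sym (m≤n⇒m⊓n≡m (<⇒≤ u<v)))) (Fin.suc-injective (Maybe.just-injective eq)))
            _ (block b t u Fin.≟ c))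
    (≤-trans (≤-reflexive (sym (*-identityʳ _))) (m≤m+n _ _))
  ... | second = ≤-trans
    (𝟙-mono (λ eq → trans (cong (block b t) (sym (m≤n⇒m⊔n≡n (<⇒≤ u<v)))) (Fin.suc-injective (Maybe.just-injective eq)))
            _ (block b t v Fin.≟ c))
    (≤-trans (≤-reflexive (sym (*-identityʳ _))) (m≤n+m _ (𝟙 (block b t u Fin.≟ c) * 0)))
  ... | spare  = z≤n

  -- Tells whether `u` is the endpoint that decides the demand of the edge uv.
  owned : ℕ → ℕ → ℕ
  owned u v = 𝟙 (u <? v) * isFirst (kind h (u + v)) + 𝟙 (v <? u) * isSecond (kind h (v + u))

  -- The vertices above and below `u` form two intervals, and in each of them `h` residues out of a
  -- period count. Each interval costs an error of one period.
  owned-upper : ∀ n u → u ≤ n → period h * sum< n (owned u) ≤ h * (n + 2 * period h)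
  owned-upper n u u≤n = begin
    L * sum< n (owned u)                              ≡⟨ cong (L *_) (sum<-distrib-+ n _ _) ⟩
    L * (sum< n (λ v → 𝟙 (u <? v) * F v) + sum< n (λ v → 𝟙 (v <? u) * S v))
      ≤⟨ *-monoʳ-≤ L (+-mono-≤ (sum<-above u≤n F) (sum<-below u≤n S)) ⟩
    L * (sum< (n ∸ u) (λ i → F (u + i)) + sum< u S)     ≡⟨ *-distribˡ-+ L (sum< (n ∸ u) (λ i → F (u + i))) (sum< u S) ⟩
    L * sum< (n ∸ u) (λ i → F (u + i)) + L * sum< u S
      ≡⟨ cong₂ _+_ (cong (L *_) (sum<-cong (n ∸ u) λ i _ → cong (isFirst ∘ kind h) (sym (+-assoc u u i))))
                   (cong (L *_) (sum<-cong u λ i _ → cong (isSecond ∘ kind h) (+-comm i u))) ⟩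
    L * sum< (n ∸ u) (λ i → isFirst (kind h (u + u + i))) + L * sum< u (λ i → isSecond (kind h (u + i)))
      ≤⟨ +-mono-≤ (KindSums.upper h isFirst h (lemma₁ h) (n ∸ u) (u + u)) (KindSums.upper h isSecond h (lemma₁ h) u u) ⟩
    h * (n ∸ u + L) + h * (u + L)                       ≡⟨ lemma₂ h (n ∸ u) u L ⟩
    h * (n ∸ u + u + 2 * L)                             ≡⟨ cong (λ k → h * (k + 2 * L)) (m∸n+n≡m u≤n) ⟩
    h * (n + 2 * L)                                     ∎
    where
    open ≤-Reasoning
    L = period h
    F = λ v → isFirst (kind h (u + v))
    S = λ v → isSecond (kind h (v + u))
    lemma₁ : ∀ h → h * 1 + 0 ≡ h
    lemma₁ = solve-∀
    lemma₂ : ∀ h m u L → h * (m + L) + h * (u + L) ≡ h * (m + u + 2 * L)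
    lemma₂ = solve-∀

  weight : ∀ {a b} {A : Set a} {B : Set b} → Dec A → Dec B → Kind → ℕ
  weight (yes _) _       = isSecond
  weight (no _)  (yes _) = isOwned
  weight (no _)  (no _)  = isFirst

  -- The edge uv surely asks for the colour of u if v precedes the block of u and the larger endpoint decides, if v is
  -- among the first b vertices of the block and either endpoint decides, or if v comes later and the smaller one decides.
  ownDegreeBound : ℕ → ℕ → ℕ
  ownDegreeBound u v = weight (v <? lo) (v <? lo + b) (kind h (u + v))
    where lo = toℕ (block b t u) * b

  ownDegreeBound-≤ : ∀ u v → ownDegreeBound u v ≤ 𝟙 (wish u v ≟ₘ just (suc (block b t u)))
  ownDegreeBound-≤ u v = proof
    where
    c  = block b t u
    lo = toℕ c * b
    lo≤u : lo ≤ u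
    lo≤u = block-start b t u
    hit : ∀ {κ w} → block b t w ≡ c → owner κ u v ≡ just (suc (block b t w)) →
          ∀ {x} → x ≤ 1 → x ≤ 𝟙 (owner κ u v ≟ₘ just (suc c))
    hit {κ} w∈ eq x≤1 = ≤-trans x≤1
      (≤-reflexive (sym (𝟙-yes (trans eq (cong (just ∘ suc) w∈)) (owner κ u v ≟ₘ just (suc c)))))
    same : lo ≤ v → v < lo + b → block b t v ≡ c
    same = block-inside b t c
    min-c : lo ≤ v → block b t (u ⊓ v) ≡ c
    min-c lo≤v with ≤-total u v
    ... | inj₁ u≤v = cong (block b t) (m≤n⇒m⊓n≡m u≤v)
    ... | inj₂ v≤u = trans (cong (block b t) (m≥n⇒m⊓n≡n v≤u)) (block-convex b t lo≤v v≤u)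
    max-c : lo ≤ v → v < lo + b → block b t (u ⊔ v) ≡ c
    max-c lo≤v v<hi with ≤-total u v
    ... | inj₁ u≤v = trans (cong (block b t) (m≤n⇒m⊔n≡n u≤v)) (same lo≤v v<hi)
    ... | inj₂ v≤u = cong (block b t) (m≥n⇒m⊔n≡m v≤u)
    proof : ownDegreeBound u v ≤ 𝟙 (wish u v ≟ₘ just (suc c))
    proof with v <? lo | v <? lo + b | kind h (u + v)
    ... | yes v<lo | _        | second = hit {second} (cong (block b t) (m≥n⇒m⊔n≡m (<⇒≤ (<-≤-trans v<lo lo≤u)))) refl ≤-refl
    ... | yes v<lo | _        | first  = z≤n
    ... | yes v<lo | _        | spare  = z≤n
    ... | no v≮lo  | yes v<hi | first  = hit {first} (min-c (≮⇒≥ v≮lo)) refl ≤-refl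
    ... | no v≮lo  | yes v<hi | second = hit {second} (max-c (≮⇒≥ v≮lo) v<hi) refl ≤-refl
    ... | no v≮lo  | yes v<hi | spare  = z≤n
    ... | no v≮lo  | no _     | first  = hit {first} (min-c (≮⇒≥ v≮lo)) refl ≤-refl
    ... | no v≮lo  | no _     | second = z≤n
    ... | no v≮lo  | no _     | spare  = z≤n

  -- Three intervals are summed, before, within and after the first `b` vertices of the block. The
  -- middle one counts `2 * h` residues per period, whence `n + b`; the errors `h`, `2 * h` and `h`
  -- add up to `4 * h`.
  ownDegreeBound-sum : ∀ n u → suc t * b ≤ n → h * (n + b) ≤ period h * (sum< n (ownDegreeBound u) + 4 * h)
  ownDegreeBound-sum n u tb≤n = begin
    h * (n + b)                                               ≡⟨ cong (λ k → h * (k + b)) n≡ ⟨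
    h * (lo + (b + rest) + b)                                 ≡⟨ lemma₂ h lo b rest ⟩
    h * lo + 2 * h * b + h * rest
      ≤⟨ +-mono-≤ (+-mono-≤ (KindSums.lower h isSecond h (lemma₁ h) lo u)
                            (KindSums.lower h isOwned (2 * h) (lemma₃ h) b (u + lo)))
                  (KindSums.lower h isFirst h (lemma₁ h) rest (u + lo + b)) ⟩
    L * (s₁ + h) + L * (s₂ + 2 * h) + L * (s₃ + h)            ≡⟨ lemma₄ L h s₁ s₂ s₃ ⟩
    L * (s₁ + (s₂ + s₃) + 4 * h)                              ≡⟨ cong (λ k → L * (k + 4 * h)) pieces ⟨
    L * (sum< n (ownDegreeBound u) + 4 * h)                   ∎
    where
    open ≤-Reasoning
    L    = period h
    c    = block b t u
    lo   = toℕ c * b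
    rest = n ∸ (lo + b)
    s₁   = sum< lo (λ v → isSecond (kind h (u + v)))
    s₂   = sum< b (λ i → isOwned (kind h (u + lo + i)))
    s₃   = sum< rest (λ i → isFirst (kind h (u + lo + b + i)))
    lemma₁ : ∀ h → h * 1 + 0 ≡ h
    lemma₁ = solve-∀
    lemma₃ : ∀ h → h * 2 + 0 ≡ 2 * h
    lemma₃ = solve-∀
    lemma₂ : ∀ h lo b rest → h * (lo + (b + rest) + b) ≡ h * lo + 2 * h * b + h * rest
    lemma₂ = solve-∀
    lemma₄ : ∀ L h x y z → L * (x + h) + L * (y + 2 * h) + L * (z + h) ≡ L * (x + (y + z) + 4 * h)
    lemma₄ = solve-∀
    lo+b≤n : lo + b ≤ n
    lo+b≤n = ≤-trans (≤-reflexive (+-comm lo b)) (≤-trans (*-monoˡ-≤ b (Fin.toℕ<n c)) tb≤n)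
    n≡ : lo + (b + rest) ≡ n
    n≡ = trans (sym (+-assoc lo b rest)) (m+[n∸m]≡n lo+b≤n)
    w = ownDegreeBound u
    weight-yes : ∀ {v} {B : Set} (d : Dec B) κ → v < lo → weight (v <? lo) d κ ≡ isSecond κ
    weight-yes {v} d κ v<lo with v <? lo
    ... | yes _  = refl
    ... | no v≮lo = contradiction v<lo v≮lo
    weight-no-yes : ∀ {v} κ → lo ≤ v → v < lo + b → weight (v <? lo) (v <? lo + b) κ ≡ isOwned κ
    weight-no-yes {v} κ lo≤v v<hi with v <? lo | v <? lo + b
    ... | yes v<lo | _       = contradiction lo≤v (<⇒≱ v<lo)
    ... | no _     | yes _   = refl
    ... | no _     | no v≮hi = contradiction v<hi v≮hi
    weight-no-no : ∀ {v} κ → lo + b ≤ v → weight (v <? lo) (v <? lo + b) κ ≡ isFirst κ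
    weight-no-no {v} κ hi≤v with v <? lo | v <? lo + b
    ... | yes v<lo | _       = contradiction (≤-trans (m≤m+n lo b) hi≤v) (<⇒≱ v<lo)
    ... | no _     | yes v<hi = contradiction hi≤v (<⇒≱ v<hi)
    ... | no _     | no _    = refl
    pieces : sum< n w ≡ s₁ + (s₂ + s₃)
    pieces = trans (cong (λ k → sum< k w) (sym n≡)) (trans (sum<-+ lo (b + rest) w) (cong₂ _+_
      (sum<-cong lo (λ v v<lo → weight-yes (v <? lo + b) (kind h (u + v)) v<lo))
      (trans (sum<-+ b rest (λ i → w (lo + i))) (cong₂ _+_
        (sum<-cong b (λ i i<b → trans (weight-no-yes (kind h (u + (lo + i))) (m≤m+n lo i) (+-monoʳ-< lo i<b))
                                      (cong (isOwned ∘ kind h) (sym (+-assoc u lo i)))))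
        (sum<-cong rest (λ i _ → trans
          (weight-no-no (kind h (u + (lo + (b + i)))) (+-monoʳ-≤ lo (m≤m+n b i)))
          (cong (isFirst ∘ kind h) (lemma₅ u lo b i))))))))
      where
      lemma₅ : ∀ u lo b i → u + (lo + (b + i)) ≡ u + lo + b + i
      lemma₅ = solve-∀

  spare-sum : ∀ n u → period h * sum< n (λ v → isSpare (kind h (u + v))) ≤ 26 * (n + period h)
  spare-sum n u = KindSums.upper h isSpare 26 (lemma h) n u
    where
    lemma : ∀ h → h * 0 + 26 ≡ 26
    lemma = solve-∀

  module _ {n : ℕ} where

    pairWish : Fin n × Fin n → Maybe (Fin (2 + t))
    pairWish (u , v) = wish (toℕ u) (toℕ v)

    -- Double counting over the deciding endpoints. Exchanging the order of summation in the
    -- `second` part makes `u` the decider in both parts.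
    pairWish-charge : ∀ c →
      sum {n} (λ u → sum {n} λ v → 𝟙 (u Fin.<? v) * 𝟙 (pairWish (u , v) ≟ₘ just (suc c)))
      ≤ sum {n} (λ u → 𝟙 (block b t (toℕ u) Fin.≟ c) * sum< n (owned (toℕ u)))
    pairWish-charge c = begin
      sum {n} (λ u → sum {n} λ v → 𝟙 (u Fin.<? v) * 𝟙 (pairWish (u , v) ≟ₘ just (suc c)))
        ≤⟨ sum-mono {n} (λ u → sum-mono {n} (λ v → pointwise u v)) ⟩
      sum {n} (λ u → sum {n} λ v → β u * F u v + β v * S u v)
        ≡⟨ sum-cong-≗ {n} (λ u → ∑-distrib-+ {n} (λ v → β u * F u v) (λ v → β v * S u v)) ⟩
      sum {n} (λ u → sum {n} (λ v → β u * F u v) + sum {n} (λ v → β v * S u v))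
        ≡⟨ ∑-distrib-+ {n} (λ u → sum {n} (λ v → β u * F u v)) (λ u → sum {n} (λ v → β v * S u v)) ⟩
      sum {n} (λ u → sum {n} (λ v → β u * F u v)) + sum {n} (λ u → sum {n} (λ v → β v * S u v))
        ≡⟨ cong (sum {n} (λ u → sum {n} (λ v → β u * F u v)) +_) (∑-comm {n} {n} (λ u v → β v * S u v)) ⟩
      sum {n} (λ u → sum {n} (λ v → β u * F u v)) + sum {n} (λ u → sum {n} (λ v → β u * S v u))
        ≡⟨ ∑-distrib-+ {n} (λ u → sum {n} (λ v → β u * F u v)) (λ u → sum {n} (λ v → β u * S v u)) ⟨
      sum {n} (λ u → sum {n} (λ v → β u * F u v) + sum {n} (λ v → β u * S v u))
        ≡⟨ sum-cong-≗ {n} (λ u → collect u) ⟩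
      sum {n} (λ u → β u * sum< n (owned (toℕ u))) ∎
      where
      open ≤-Reasoning
      β : Fin n → ℕ
      β u = 𝟙 (block b t (toℕ u) Fin.≟ c)
      F S : Fin n → Fin n → ℕ
      F u v = 𝟙 (toℕ u <? toℕ v) * isFirst (kind h (toℕ u + toℕ v))
      S u v = 𝟙 (toℕ u <? toℕ v) * isSecond (kind h (toℕ u + toℕ v))
      collect : ∀ u → sum {n} (λ v → β u * F u v) + sum {n} (λ v → β u * S v u) ≡ β u * sum< n (owned (toℕ u))
      collect u = trans (cong₂ _+_ (sym (*-distribˡ-sum {n} (β u) (F u))) (sym (*-distribˡ-sum {n} (β u) (λ v → S v u))))
        (trans (sym (*-distribˡ-+ (β u) (sum {n} (F u)) (sum {n} (λ v → S v u))))
          (cong (β u *_) (trans (sym (∑-distrib-+ {n} (F u) (λ v → S v u))) (sum-toℕ n (owned (toℕ u))))))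
      pointwise : ∀ u v → 𝟙 (u Fin.<? v) * 𝟙 (pairWish (u , v) ≟ₘ just (suc c)) ≤ β u * F u v + β v * S u v
      pointwise u v with toℕ u <? toℕ v
      ... | no _    = z≤n
      ... | yes u<v = begin
        1 * 𝟙 (wish (toℕ u) (toℕ v) ≟ₘ just (suc c))  ≡⟨ *-identityˡ _ ⟩
        𝟙 (wish (toℕ u) (toℕ v) ≟ₘ just (suc c))      ≤⟨ charge (toℕ u) (toℕ v) c u<v ⟩
        β u * f + β v * s                              ≡⟨ cong₂ (λ x y → β u * x + β v * y) (*-identityˡ f) (*-identityˡ s) ⟨
        β u * (1 * f) + β v * (1 * s)                  ∎
        where
        f = isFirst (kind h (toℕ u + toℕ v))
        s = isSecond (kind h (toℕ u + toℕ v))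

    -- A block has at most `b + e` vertices, and each of them decides about h n / L edges.
    pairWish-count : ∀ e c → n ≤ suc t * b + e →
      period h * sum {n} (λ u → sum {n} λ v → 𝟙 (u Fin.<? v) * 𝟙 (pairWish (u , v) ≟ₘ just (suc c)))
      ≤ (b + e) * (h * (n + 2 * period h))
    pairWish-count e c n≤ = begin
      L * sum {n} (λ u → sum {n} λ v → 𝟙 (u Fin.<? v) * 𝟙 (pairWish (u , v) ≟ₘ just (suc c)))
        ≤⟨ *-monoʳ-≤ L (pairWish-charge c) ⟩
      L * sum {n} (λ u → β u * sum< n (owned (toℕ u)))       ≡⟨ *-distribˡ-sum {n} L (λ u → β u * sum< n (owned (toℕ u))) ⟩
      sum {n} (λ u → L * (β u * sum< n (owned (toℕ u))))     ≤⟨ sum-mono {n} (λ u → each u) ⟩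
      sum {n} (λ u → β u * (h * (n + 2 * L)))                ≡⟨ *-distribʳ-sum {n} (h * (n + 2 * L)) β ⟨
      sum {n} β * (h * (n + 2 * L))
        ≤⟨ *-monoˡ-≤ (h * (n + 2 * L)) (≤-trans (≤-reflexive (sum-toℕ n (λ u → 𝟙 (block b t u Fin.≟ c)))) (block-size b t e n c n≤)) ⟩
      (b + e) * (h * (n + 2 * L))                            ∎
      where
      open ≤-Reasoning
      L = period h
      β : Fin n → ℕ
      β u = 𝟙 (block b t (toℕ u) Fin.≟ c)
      each : ∀ u → L * (β u * sum< n (owned (toℕ u))) ≤ β u * (h * (n + 2 * L))
      each u = ≤-trans (≤-reflexive (lemma L (β u) _)) (*-monoʳ-≤ (β u) (owned-upper n (toℕ u) (<⇒≤ (Fin.toℕ<n u))))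
        where
        lemma : ∀ x y z → x * (y * z) ≡ y * (x * z)
        lemma = solve-∀

-- Forests

lookup-injective : ∀ {a} {A : Set a} {xs : List A} → Unique xs → ∀ {i j} → lookup xs i ≡ lookup xs j → i ≡ j
lookup-injective (x∉xs ∷ u) {zero}  {zero}  _  = refl
lookup-injective (x∉xs ∷ u) {zero}  {suc j} eq = contradiction eq (All.lookup x∉xs (∈-lookup j))
lookup-injective (x∉xs ∷ u) {suc i} {zero}  eq = contradiction (sym eq) (All.lookup x∉xs (∈-lookup i))
lookup-injective (x∉xs ∷ u) {suc i} {suc j} eq = cong suc (lookup-injective u eq)

-- The visited vertices are an index, so that a walk is simple when its list is `Unique`.
data Walk {A : Set} (R : Rel A 0ℓ) : A → A → List A → Set where
  [-] : ∀ {x} → Walk R x x (x ∷ [])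
  _∷_ : ∀ {x y z zs} → R x z → Walk R z y zs → Walk R x y (x ∷ zs)

module _ {A : Set} {R : Rel A 0ℓ} where

  join : ∀ {x a b y zs ws} → Walk R x a zs → R a b → Walk R b y ws → Walk R x y (zs ++ ws)
  join [-]     r w = r ∷ w
  join (s ∷ v) r w = s ∷ join v r w

  map-walk : ∀ {S : Rel A 0ℓ} {x y zs} → (∀ {a b} → R a b → S a b) → Walk R x y zs → Walk S x y zs
  map-walk f [-]     = [-]
  map-walk f (r ∷ w) = f r ∷ map-walk f w

  walk-start : ∀ {x y z zs} → Walk R x y (z ∷ zs) → x ≡ z
  walk-start [-]     = refl
  walk-start (_ ∷ _) = refl

  walk-end : ∀ {x y z zs} → Walk R x y (z ∷ zs) → lookup (z ∷ zs) (fromℕ (length zs)) ≡ y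
  walk-end [-]                    = refl
  walk-end (r ∷ [-])              = refl
  walk-end (r ∷ (s ∷ w))          = walk-end (s ∷ w)

  walk-step : ∀ {x y z zs} → Walk R x y (z ∷ zs) → ∀ (i : Fin (length zs)) →
              R (lookup (z ∷ zs) (inject₁ i)) (lookup zs i)
  walk-step (r ∷ [-])     zero    = r
  walk-step (r ∷ (s ∷ w)) zero    = r
  walk-step (r ∷ (s ∷ w)) (suc i) = walk-step (s ∷ w) i

walk⇒cycle : ∀ {n} (G : Graph n) {x y a b c zs} → Walk (Adj G) x y (a ∷ b ∷ c ∷ zs) →
             Unique (a ∷ b ∷ c ∷ zs) → Adj G y x → Cycle G
walk⇒cycle G {a = a} {b} {c} {zs} w u yx = record
  { k        = length zs
  ; vertex   = lookup (a ∷ b ∷ c ∷ zs)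
  ; distinct = lookup-injective u
  ; step     = walk-step w
  ; closing  = subst₂ (Adj G) (sym (walk-end w)) (walk-start w) yx
  }

Joins : ∀ {A : Set} → List (A × A) → Rel A 0ℓ
Joins es x y = (x , y) ∈ es ⊎ (y , x) ∈ es

merge : ∀ {n} → Fin n → Fin n → Fin n → Fin n
merge a b c with c Fin.≟ b
... | yes _ = a
... | no _  = c

merge-≡ : ∀ {n} (a b : Fin n) {c} → c ≡ b → merge a b c ≡ a
merge-≡ a b {c} c≡b with c Fin.≟ b
... | yes _  = refl
... | no c≢b = contradiction c≡b c≢b

merge-≢ : ∀ {n} (a b : Fin n) {c} → c ≢ b → merge a b c ≡ c
merge-≢ a b {c} c≢b with c Fin.≟ b
... | yes c≡b = contradiction c≡b c≢b
... | no _    = refl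

-- The fibres of label are the components of the forest es, and every component
-- contains exactly one vertex labelled by itself.
record Components {n : ℕ} (es : List (Fin n × Fin n)) : Set where
  field
    label      : Fin n → Fin n
    idempotent : ∀ x → label (label x) ≡ label x
    count      : sum (λ x → 𝟙 (label x Fin.≟ x)) + length es ≡ n
    connect    : ∀ x y → label x ≡ label y →
                 ∃[ zs ] (Walk (Joins es) x y zs × Unique zs × All (λ z → label z ≡ label x) zs)

module _ {n : ℕ} (G : Graph n) (acyclic : ¬ Cycle G) where

  IsEdge : Fin n × Fin n → Set
  IsEdge (u , v) = toℕ u < toℕ v × Adj G u v

  joins⇒adj : ∀ {es} → All IsEdge es → ∀ {x y} → Joins es x y → Adj G x y
  joins⇒adj ok (inj₁ xy∈) = proj₂ (All.lookup ok xy∈)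
  joins⇒adj ok (inj₂ yx∈) = adj-sym G (proj₂ (All.lookup ok yx∈))

  -- A walk without steps contradicts u < v. A single step would be the new edge itself, or its
  -- reverse, which is not listed in increasing order. A longer simple walk is closed by uv to a
  -- cycle.
  no-walk : ∀ {u v es} → All ((u , v) ≢_) es → All IsEdge es → IsEdge (u , v) →
            ∀ {zs} → Walk (Joins es) u v zs → ¬ Unique zs
  no-walk new ok (u<v , _)  [-] _                     = <-irrefl refl u<v
  no-walk new ok (u<v , _)  (inj₁ uv∈ ∷ [-]) _        = All.lookup new uv∈ refl
  no-walk new ok (u<v , _)  (inj₂ vu∈ ∷ [-]) _        = <-asym u<v (proj₁ (All.lookup ok vu∈))
  no-walk new ok (_ , uv)   w@(_ ∷ (_ ∷ [-])) uniq    =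
    acyclic (walk⇒cycle G (map-walk (joins⇒adj ok) w) uniq (adj-sym G uv))
  no-walk new ok (_ , uv)   w@(_ ∷ (_ ∷ (_ ∷ _))) uniq =
    acyclic (walk⇒cycle G (map-walk (joins⇒adj ok) w) uniq (adj-sym G uv))

  -- Union-find: by `no-walk` a new edge joins two different components, and relabelling the
  -- component of `v` by the label of `u` loses exactly one root.
  components : ∀ es → Unique es → All IsEdge es → Components es
  components [] _ _ = record
    { label      = id
    ; idempotent = λ _ → refl
    ; count      = trans (+-identityʳ _) (trans (sum-cong-≗ {n} (λ x → 𝟙-yes refl (x Fin.≟ x)))
                     (trans (sum-const n 1) (*-identityʳ n)))
    ; connect    = λ { x .x refl → x ∷ [] , [-] , [] ∷ [] , refl ∷ [] }
    }
  components ((u , v) ∷ es) (new ∷ uniq) (uv ∷ ok) with components es uniq ok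
  ... | record { label = ℓ ; idempotent = ℓℓ ; count = count ; connect = connect } = record
    { label      = ℓ′
    ; idempotent = idempotent′
    ; count      = trans (+-suc _ _) (trans (cong (_+ length es) (trans (+-comm 1 _) (sym count-roots))) count)
    ; connect    = connect′
    }
    where
    ℓu≢ℓv : ℓ u ≢ ℓ v
    ℓu≢ℓv eq with connect u v eq
    ... | zs , w , simple , _ = no-walk new ok uv w simple
    ℓ′ : Fin n → Fin n
    ℓ′ x = merge (ℓ u) (ℓ v) (ℓ x)
    idempotent′ : ∀ x → ℓ′ (ℓ′ x) ≡ ℓ′ x
    idempotent′ x with ℓ x Fin.≟ ℓ v
    ... | yes _   = trans (merge-≢ (ℓ u) (ℓ v) (λ eq → ℓu≢ℓv (trans (sym (ℓℓ u)) eq))) (ℓℓ u)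
    ... | no x≢v  = trans (merge-≢ (ℓ u) (ℓ v) (λ eq → x≢v (trans (sym (ℓℓ x)) eq))) (ℓℓ x)
    -- Only `ℓ v` stops being a root, since its label becomes `ℓ u`.
    root-lost : ∀ x → 𝟙 (ℓ x Fin.≟ x) ≡ 𝟙 (ℓ′ x Fin.≟ x) + 𝟙 (x Fin.≟ ℓ v)
    root-lost x with ℓ x Fin.≟ ℓ v
    ... | yes x~v = trans
      (𝟙-cong (λ eq → trans (sym eq) x~v) (λ eq → trans x~v (sym eq)) (ℓ x Fin.≟ x) (x Fin.≟ ℓ v))
      (cong (_+ 𝟙 (x Fin.≟ ℓ v)) (sym (𝟙-no (λ { refl → ℓu≢ℓv (trans (sym (ℓℓ u)) x~v) }) (ℓ u Fin.≟ x))))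
    ... | no x≁v  = sym (trans (cong (𝟙 (ℓ x Fin.≟ x) +_) (𝟙-no (λ { refl → x≁v (ℓℓ v) }) (x Fin.≟ ℓ v))) (+-identityʳ _))
    count-roots : sum (λ x → 𝟙 (ℓ x Fin.≟ x)) ≡ sum (λ x → 𝟙 (ℓ′ x Fin.≟ x)) + 1
    count-roots = trans (sum-cong-≗ {n} root-lost) (trans
      (∑-distrib-+ {n} (λ x → 𝟙 (ℓ′ x Fin.≟ x)) (λ x → 𝟙 (x Fin.≟ ℓ v)))
      (cong (sum (λ x → 𝟙 (ℓ′ x Fin.≟ x)) +_) (sum-≡₁ (ℓ v))))
    Path : Fin n → Fin n → Set
    Path x y = ∃[ zs ] (Walk (Joins ((u , v) ∷ es)) x y zs × Unique zs × All (λ z → ℓ′ z ≡ ℓ′ x) zs)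
    weaken : ∀ {a b} → Joins es a b → Joins ((u , v) ∷ es) a b
    weaken = Sum.map there there
    old : ∀ {x y} → ℓ x ≡ ℓ y → Path x y
    old {x} {y} x~y with connect x y x~y
    ... | zs , w , simple , inside = zs , map-walk weaken w , simple , All.map (cong (merge (ℓ u) (ℓ v))) inside
    -- The two walks stay in different old components, hence are disjoint, and their concatenation
    -- is simple. This is why `connect` records the labels along a walk.
    bridge : ∀ {x a b y} → ℓ x ≡ ℓ a → Joins ((u , v) ∷ es) a b → ℓ b ≡ ℓ y → ℓ x ≢ ℓ y → ℓ′ x ≡ ℓ′ y → Path x y
    bridge {x} {a} {b} {y} x~a ab b~y x≁y x~′y with connect x a x~a | connect b y b~y
    ... | zs , w , simple , inside | ws , w′ , simple′ , inside′ =
      zs ++ ws , join (map-walk weaken w) ab (map-walk weaken w′) ,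
      Unique.++⁺ simple simple′ (λ (z∈zs , z∈ws) → x≁y (trans (sym (All.lookup inside z∈zs)) (trans (All.lookup inside′ z∈ws) b~y))) ,
      All.++⁺ (All.map (cong (merge (ℓ u) (ℓ v))) inside)
              (All.map (λ z~b → trans (cong (merge (ℓ u) (ℓ v)) (trans z~b b~y)) (sym x~′y)) inside′)
    connect′ : ∀ x y → ℓ′ x ≡ ℓ′ y → Path x y
    connect′ x y eq = by-cases (ℓ x Fin.≟ ℓ v) (ℓ y Fin.≟ ℓ v)
      where
      by-cases : Dec (ℓ x ≡ ℓ v) → Dec (ℓ y ≡ ℓ v) → Path x y
      by-cases (yes x~v) (yes y~v) = old (trans x~v (sym y~v))
      by-cases (no x≁v)  (no y≁v)  = old (trans (sym (merge-≢ _ _ x≁v)) (trans eq (merge-≢ _ _ y≁v)))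
      by-cases (yes x~v) (no y≁v)  =
        bridge x~v (inj₂ (here refl)) (trans (sym (merge-≡ _ _ x~v)) (trans eq (merge-≢ _ _ y≁v)))
               (λ x~y → y≁v (trans (sym x~y) x~v)) eq
      by-cases (no x≁v)  (yes y~v) =
        bridge (trans (sym (merge-≢ _ _ x≁v)) (trans eq (merge-≡ _ _ y~v))) (inj₁ (here refl)) (sym y~v)
               (λ x~y → x≁v (trans x~y y~v)) eq

edges-unique : ∀ {n} (G : Graph n) → Unique (edges G)
edges-unique {n} G = Unique.filter⁺ _ (Unique.cartesianProduct⁺ (Unique.allFin⁺ n) (Unique.allFin⁺ n))

-- Roots and edges together number `n`, and the label of any vertex is a root.
forest-edges : ∀ {n} (G : Graph n) → ¬ Cycle G → Fin n → length (edges G) < n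
forest-edges {n} G acyclic r = begin-strict
  length (edges G)                                             <⟨ m<n+m (length (edges G)) (≤-trans (≤-reflexive (sym root)) (term≤sum _ (label r))) ⟩
  sum (λ x → 𝟙 (label x Fin.≟ x)) + length (edges G)           ≡⟨ count ⟩
  n                                                            ∎
  where
  open ≤-Reasoning
  open Components (components G acyclic (edges G) (edges-unique G) (All.all-filter _ (cartesianProduct (allFin n) (allFin n))))
  root : 𝟙 (label (label r) Fin.≟ label r) ≡ 1
  root = 𝟙-yes (idempotent r) (label (label r) Fin.≟ label r)

-- Edge sums in graphs

∑< : ∀ {n} → (Fin n → Fin n → ℕ) → ℕ
∑< {n} a = sum {n} λ u → sum {n} λ v → 𝟙 (u Fin.<? v) * a u v

∑∑ : ∀ {n} → (Fin n → Fin n → ℕ) → ℕ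
∑∑ {n} a = sum {n} λ u → sum {n} λ v → a u v

module _ {n : ℕ} where

  ∑∑-cong : {a b : Fin n → Fin n → ℕ} → (∀ u v → a u v ≡ b u v) → ∑∑ a ≡ ∑∑ b
  ∑∑-cong a≡b = sum-cong-≗ {n} (λ u → sum-cong-≗ {n} (a≡b u))

  ∑∑-mono : {a b : Fin n → Fin n → ℕ} → (∀ u v → a u v ≤ b u v) → ∑∑ a ≤ ∑∑ b
  ∑∑-mono a≤b = sum-mono {n} (λ u → sum-mono {n} (a≤b u))

  ∑∑-+ : (a b : Fin n → Fin n → ℕ) → ∑∑ (λ u v → a u v + b u v) ≡ ∑∑ a + ∑∑ b
  ∑∑-+ a b = trans (sum-cong-≗ {n} (λ u → ∑-distrib-+ {n} (a u) (b u)))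
                   (∑-distrib-+ {n} (λ u → sum (a u)) (λ u → sum (b u)))

  sumₗ-edges : (G : Graph n) (f : Fin n × Fin n → ℕ) →
               sumₗ f (edges G) ≡ ∑< (λ u v → 𝟙 (adj? G u v) * f (u , v))
  sumₗ-edges G f = trans (sumₗ-filter _ f (cartesianProduct (allFin n) (allFin n))) (trans
    (sumₗ-allPairs n (λ (u , v) → 𝟙 ((u Fin.<? v) ×-dec adj? G u v) * f (u , v)))
    (∑∑-cong λ u v → trans (cong (_* f (u , v)) (𝟙-× (u Fin.<? v) (adj? G u v)))
                            (*-assoc (𝟙 (u Fin.<? v)) _ _)))

  length-edges : (G : Graph n) → length (edges G) ≡ ∑< (λ u v → 𝟙 (adj? G u v))
  length-edges G = trans (sym (sumₗ-1 (edges G))) (trans (sumₗ-edges G (λ _ → 1))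
      (∑∑-cong λ u v → cong (𝟙 (u Fin.<? v) *_) (*-identityʳ _)))
    where
    sumₗ-1 : ∀ {A : Set} (xs : List A) → sumₗ (λ _ → 1) xs ≡ length xs
    sumₗ-1 []       = refl
    sumₗ-1 (x ∷ xs) = cong suc (sumₗ-1 xs)

  colourCount-sum : ∀ {r} {G : Graph n} (c : EdgeColouring G r) (H : Graph n) i →
                    colourCount c H i ≡ ∑< (λ u v → 𝟙 (adj? H u v) * 𝟙 (colour c u v ≟ i))
  colourCount-sum c H i = trans (length-filter _ (edges H)) (sumₗ-edges H (λ (u , v) → 𝟙 (colour c u v ≟ i)))

  degree-sum : (G : Graph n) (u : Fin n) → degree G u ≡ sum (λ v → 𝟙 (adj? G u v))
  degree-sum G u = trans (length-filter (adj? G u) (allFin n)) (sumₗ-tabulate (𝟙 ∘ adj? G u) {n} id)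

  -- All ordered pairs are sorted into u < v, v < u and the diagonal. The form avoids both division
  -- and subtraction.
  length-edges-K : 2 * length (edges (K n)) + n ≡ n * n
  length-edges-K = begin
    2 * length (edges (K n)) + n               ≡⟨ cong (λ m → 2 * m + n) (length-edges (K n)) ⟩
    2 * ∑< κ + n                             ≡⟨ cong₂ _+_ (cong (∑< κ +_) (trans (+-identityʳ (∑< κ)) swap)) (sym diagonal) ⟩
    ∑< κ + ∑∑ (λ u v → 𝟙 (v Fin.<? u) * κ v u) + ∑∑ δ
      ≡⟨ trans (∑∑-+ (λ u v → 𝟙 (u Fin.<? v) * κ u v + 𝟙 (v Fin.<? u) * κ v u) δ) (cong (_+ ∑∑ δ) (∑∑-+ (λ u v → 𝟙 (u Fin.<? v) * κ u v) (λ u v → 𝟙 (v Fin.<? u) * κ v u))) ⟨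
    ∑∑ (λ u v → 𝟙 (u Fin.<? v) * κ u v + 𝟙 (v Fin.<? u) * κ v u + 𝟙 (v Fin.≟ u))
      ≡⟨ ∑∑-cong one ⟩
    ∑∑ (λ (u v : Fin n) → 1)                   ≡⟨ sum-cong-≗ {n} (λ _ → trans (sum-const n 1) (*-identityʳ n)) ⟩
    sum {n} (λ _ → n)                          ≡⟨ sum-const n n ⟩
    n * n                                      ∎
    where
    open ≡-Reasoning
    κ : Fin n → Fin n → ℕ
    κ u v = 𝟙 (adj? (K n) u v)
    δ : Fin n → Fin n → ℕ
    δ u v = 𝟙 (v Fin.≟ u)
    swap : ∑< κ ≡ ∑∑ (λ u v → 𝟙 (v Fin.<? u) * κ v u)
    swap = ∑-comm {n} {n} (λ u v → 𝟙 (u Fin.<? v) * κ u v)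
    diagonal : ∑∑ δ ≡ n
    diagonal = trans (sum-cong-≗ {n} {λ u → sum (δ u)} {λ _ → 1} sum-≡₁) (trans (sum-const n 1) (*-identityʳ n))
    one : ∀ u v → 𝟙 (u Fin.<? v) * κ u v + 𝟙 (v Fin.<? u) * κ v u + 𝟙 (v Fin.≟ u) ≡ 1
    one u v with Fin.<-cmp u v
    ... | tri< u<v u≢v v≮u rewrite 𝟙-yes u<v (u Fin.<? v) | 𝟙-yes u≢v (adj? (K n) u v)
                                 | 𝟙-no v≮u (v Fin.<? u) | 𝟙-no (u≢v ∘ sym) (v Fin.≟ u) = refl
    ... | tri≈ u≮v u≡v v≮u rewrite 𝟙-no u≮v (u Fin.<? v) | 𝟙-no v≮u (v Fin.<? u) | 𝟙-yes (sym u≡v) (v Fin.≟ u) = refl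
    ... | tri> u≮v u≢v v<u rewrite 𝟙-no u≮v (u Fin.<? v) | 𝟙-yes v<u (v Fin.<? u)
                                 | 𝟙-yes (≢-sym u≢v) (adj? (K n) v u) | 𝟙-no (u≢v ∘ sym) (v Fin.≟ u) = refl

  module _ (a : Fin n → Fin n → ℕ) (a-sym : ∀ u v → a u v ≡ a v u) (w : Fin n) (aww≡0 : a w w ≡ 0) where

    avoiding : ℕ
    avoiding = ∑< (λ u v → 𝟙 (¬? (u Fin.≟ w) ×-dec ¬? (v Fin.≟ w)) * a u v)

    -- An edge at `w` is listed as `(w , v)` or as `(u , w)`, according to the order. Symmetry turns
    -- both lists into the row of `w`, whose diagonal entry has to vanish.
    ∑<-at : ∑< a ≡ sum (a w) + avoiding
    ∑<-at = begin
      ∑< a                                             ≡⟨ ∑∑-cong cases ⟩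
      ∑∑ (λ u v → p u v + q u v + rest u v)              ≡⟨ trans (∑∑-+ (λ u v → p u v + q u v) rest) (cong (_+ avoiding) (∑∑-+ p q)) ⟩
      ∑∑ p + ∑∑ q + avoiding                             ≡⟨ cong (_+ avoiding) (cong₂ _+_ ∑∑p ∑∑q) ⟩
      sum (λ v → 𝟙 (w Fin.<? v) * a w v) + sum (λ v → 𝟙 (v Fin.<? w) * a w v) + avoiding
                                                         ≡⟨ cong (_+ avoiding) (trans (sym (∑-distrib-+ {n} _ _)) (sum-cong-≗ {n} sides)) ⟩
      sum (a w) + avoiding                               ∎
      where
      open ≡-Reasoning
      p q rest : Fin n → Fin n → ℕ
      p u v = 𝟙 (u Fin.≟ w) * (𝟙 (w Fin.<? v) * a w v)
      q u v = 𝟙 (v Fin.≟ w) * (𝟙 (u Fin.<? w) * a w u)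
      rest u v = 𝟙 (u Fin.<? v) * (𝟙 (¬? (u Fin.≟ w) ×-dec ¬? (v Fin.≟ w)) * a u v)
      ∑∑p : ∑∑ p ≡ sum (λ v → 𝟙 (w Fin.<? v) * a w v)
      ∑∑p = trans (sum-cong-≗ {n} λ u → sym (*-distribˡ-sum {n} (𝟙 (u Fin.≟ w)) (λ v → 𝟙 (w Fin.<? v) * a w v)))
                  (sum-≡ w (λ _ → sum (λ v → 𝟙 (w Fin.<? v) * a w v)))
      ∑∑q : ∑∑ q ≡ sum (λ u → 𝟙 (u Fin.<? w) * a w u)
      ∑∑q = sum-cong-≗ {n} λ u → sum-≡ w (λ _ → 𝟙 (u Fin.<? w) * a w u)
      sides : ∀ v → 𝟙 (w Fin.<? v) * a w v + 𝟙 (v Fin.<? w) * a w v ≡ a w v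
      sides v with Fin.<-cmp w v
      ... | tri< w<v _ v≮w rewrite 𝟙-yes w<v (w Fin.<? v) | 𝟙-no v≮w (v Fin.<? w) =
        trans (+-identityʳ _) (*-identityˡ _)
      ... | tri≈ w≮v refl v≮w rewrite 𝟙-no w≮v (w Fin.<? v) = sym aww≡0
      ... | tri> w≮v _ v<w rewrite 𝟙-no w≮v (w Fin.<? v) | 𝟙-yes v<w (v Fin.<? w) = *-identityˡ _
      cases : ∀ u v → 𝟙 (u Fin.<? v) * a u v ≡ p u v + q u v + rest u v
      cases u v with u Fin.≟ w | v Fin.≟ w
      ... | yes refl | yes refl rewrite 𝟙-no (Fin.<-irrefl refl) (w Fin.<? w) = refl
      ... | yes refl | no _ rewrite *-zeroʳ (𝟙 (w Fin.<? v)) =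
        sym (trans (+-identityʳ _) (trans (+-identityʳ _) (+-identityʳ _)))
      ... | no _ | yes refl rewrite *-zeroʳ (𝟙 (u Fin.<? w)) =
        sym (trans (+-identityʳ _) (trans (+-identityʳ _) (cong (𝟙 (u Fin.<? w) *_) (a-sym w u))))
      ... | no _ | no _ = cong (𝟙 (u Fin.<? v) *_) (sym (*-identityˡ _))

maxDegree-attained : ∀ {n} (G : Graph n) → Fin n → ∃[ v ] maxDegree G ≤ degree G v
maxDegree-attained {n} G r with argmax-sel id 0 (map (degree G) (allFin n))
-- If the maximum is the default value 0, any vertex will do.
... | inj₁ eq = r , ≤-trans (≤-reflexive eq) z≤n
... | inj₂ ∈ds with ∈-map⁻ (degree G) ∈ds
...   | v , _ , eq = v , ≤-reflexive eq

-- Transport along isomorphisms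

module _ {n : ℕ} (T H : Graph n) (iso : T ≅ H) where

  private
    π    = proj₁ iso
    adj⇔ = proj₂ iso

  iso-degree : ∀ v → degree T v ≡ degree H (π ⟨$⟩ʳ v)
  iso-degree v = begin
    degree T v                                                     ≡⟨ degree-sum T v ⟩
    sum (λ w → 𝟙 (adj? T v w))                                     ≡⟨ sum-cong-≗ {n} (λ w →
      𝟙-cong (Equivalence.to (adj⇔ v w)) (Equivalence.from (adj⇔ v w)) (adj? T v w) (adj? H (π ⟨$⟩ʳ v) (π ⟨$⟩ʳ w))) ⟩
    sum (λ w → 𝟙 (adj? H (π ⟨$⟩ʳ v) (π ⟨$⟩ʳ w)))                    ≡⟨ sum-permute (λ w → 𝟙 (adj? H (π ⟨$⟩ʳ v) w)) π ⟨
    sum (λ w → 𝟙 (adj? H (π ⟨$⟩ʳ v) w))                            ≡⟨ degree-sum H (π ⟨$⟩ʳ v) ⟨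
    degree H (π ⟨$⟩ʳ v)                                            ∎
    where open ≡-Reasoning

  iso-cycle : Cycle H → Cycle T
  iso-cycle C = record
    { k        = k
    ; vertex   = λ i → π ⟨$⟩ˡ vertex i
    ; distinct = λ eq → distinct (trans (sym (inverseʳ π)) (trans (cong (π ⟨$⟩ʳ_) eq) (inverseʳ π)))
    ; step     = λ i → pull (step i)
    ; closing  = pull closing
    }
    where
    open Cycle C
    pull : ∀ {u v} → Adj H u v → Adj T (π ⟨$⟩ˡ u) (π ⟨$⟩ˡ v)
    pull uv = Equivalence.from (adj⇔ _ _) (subst₂ (Adj H) (sym (inverseʳ π)) (sym (inverseʳ π)) uv)

-- Colour counts of a forest, seen from one vertex

module _ {n r : ℕ} (c : EdgeColouring (K n) r) where

  colourDegree : Fin n → ℕ → ℕ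
  colourDegree w i = sum (λ v → 𝟙 (¬? (w Fin.≟ v)) * 𝟙 (colour c w v ≟ i))

  -- At most n − 1 − deg w edges of the forest H avoid w, and as many edges of K n at w are missing from H.
  colourCount-≤ : (H : Graph n) → ¬ Cycle H → ∀ w i j →
                  colourDegree w i + 2 * n ≤ colourDegree w j + 2 * suc (degree H w) →
                  colourCount c H i ≤ colourCount c H j
  colourCount-≤ H acyclic w i j gap = +-cancelʳ-≤ (suc d) _ _ (begin
    colourCount c H i + suc d           ≤⟨ +-monoˡ-≤ (suc d) count-i ⟩
    Di + X + suc d                      ≡⟨ lemma₁ Di X d ⟩
    -- The summand `suc d` replaces the truncated difference n - 1 - d: here X ≤ n - 1 - d is used,
    -- and `present` bounds the missing edges of colour `j` at `w` by the same number.
    Di + suc (d + X)                    ≤⟨ +-monoʳ-≤ Di forest ⟩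
    Di + n                              ≤⟨ +-cancelʳ-≤ n _ _ (begin
      Di + n + n                          ≡⟨ lemma₂ Di n ⟩
      Di + 2 * n                          ≤⟨ gap ⟩
      Dj + 2 * suc d                      ≡⟨ lemma₃ Dj d ⟩
      Dj + d + 1 + suc d                  ≤⟨ +-monoˡ-≤ (suc d) present ⟩
      star j + n + suc d                  ≡⟨ lemma₄ (star j) n d ⟩
      star j + suc d + n                  ∎) ⟩
    star j + suc d                      ≤⟨ +-monoˡ-≤ (suc d) count-j ⟩
    colourCount c H j + suc d           ∎)
    where
    open ≤-Reasoning
    d  = degree H w
    Di = colourDegree w i
    Dj = colourDegree w j
    adj : Fin n → Fin n → ℕ
    adj u v = 𝟙 (adj? H u v)
    adj-comm : ∀ u v → adj u v ≡ adj v u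
    adj-comm u v = 𝟙-cong (adj-sym H) (adj-sym H) (adj? H u v) (adj? H v u)
    adj-ww : adj w w ≡ 0
    adj-ww = 𝟙-no (adj-irrefl H refl) (adj? H w w)
    hue : ℕ → Fin n → Fin n → ℕ
    hue k u v = adj u v * 𝟙 (colour c u v ≟ k)
    hue-comm : ∀ k u v → hue k u v ≡ hue k v u
    hue-comm k u v with adj? H u v | adj? H v u
    ... | yes uv | yes _  = cong (λ i → 1 * 𝟙 (i ≟ k)) (colour-sym c u v (λ u≡v → adj-irrefl H u≡v uv))
    ... | no _   | no _   = refl
    ... | yes uv | no ¬vu = contradiction (adj-sym H uv) ¬vu
    ... | no ¬uv | yes vu = contradiction (adj-sym H vu) ¬uv
    hue-ww : ∀ k → hue k w w ≡ 0
    hue-ww k = cong (_* 𝟙 (colour c w w ≟ k)) adj-ww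
    star : ℕ → ℕ
    star k = sum (hue k w)
    X = avoiding adj adj-comm w adj-ww
    x*𝟙≤x : ∀ {a} {A : Set a} x (A? : Dec A) → x * 𝟙 A? ≤ x
    x*𝟙≤x x A? = ≤-trans (*-monoʳ-≤ x (𝟙≤1 A?)) (≤-reflexive (*-identityʳ x))
    count-at : ∀ k → colourCount c H k ≡ star k + avoiding (hue k) (hue-comm k) w (hue-ww k)
    count-at k = trans (colourCount-sum c H k) (∑<-at (hue k) (hue-comm k) w (hue-ww k))
    count-i : colourCount c H i ≤ Di + X
    count-i = ≤-trans (≤-reflexive (count-at i)) (+-mono-≤
      (sum-mono {n} (λ v → *-monoˡ-≤ (𝟙 (colour c w v ≟ i))
        (𝟙-mono (λ wv w≡v → adj-irrefl H w≡v wv) (adj? H w v) (¬? (w Fin.≟ v)))))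
      (∑∑-mono λ u v → *-monoʳ-≤ (𝟙 (u Fin.<? v))
        (*-monoʳ-≤ (𝟙 (¬? (u Fin.≟ w) ×-dec ¬? (v Fin.≟ w))) (x*𝟙≤x (adj u v) (colour c u v ≟ i)))))
    count-j : star j ≤ colourCount c H j
    count-j = ≤-trans (m≤m+n (star j) _) (≤-reflexive (sym (count-at j)))
    forest : suc (d + X) ≤ n
    forest = ≤-trans (≤-reflexive (cong suc (trans (cong (_+ X) (degree-sum H w))
      (sym (trans (length-edges H) (∑<-at adj adj-comm w adj-ww)))))) (forest-edges H acyclic w)
    -- Inclusion and exclusion over all vertices: those joined to `w` in colour `j` and those
    -- adjacent to it in `H` overlap in the coloured star, and `w` itself is in neither set.
    present : Dj + d + 1 ≤ star j + n
    present = begin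
      Dj + d + 1                                          ≡⟨ cong₂ (λ x y → Dj + x + y) (degree-sum H w) (sym (sum-≡₁ w)) ⟩
      Dj + sum (adj w) + sum (λ v → 𝟙 (v Fin.≟ w))        ≡⟨ cong (_+ sum (λ v → 𝟙 (v Fin.≟ w))) (sym (∑-distrib-+ {n} κ (adj w))) ⟩
      sum (λ v → κ v + adj w v) + sum (λ v → 𝟙 (v Fin.≟ w)) ≡⟨ ∑-distrib-+ {n} (λ v → κ v + adj w v) (λ v → 𝟙 (v Fin.≟ w)) ⟨
      sum (λ v → κ v + adj w v + 𝟙 (v Fin.≟ w))           ≤⟨ sum-mono {n} pointwise ⟩
      sum (λ v → hue j w v + 1)                           ≡⟨ ∑-distrib-+ {n} (hue j w) (λ _ → 1) ⟩
      star j + sum {n} (λ _ → 1)                          ≡⟨ cong (star j +_) (trans (sum-const n 1) (*-identityʳ n)) ⟩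
      star j + n                                          ∎
      where
      κ : Fin n → ℕ
      κ v = 𝟙 (¬? (w Fin.≟ v)) * 𝟙 (colour c w v ≟ j)
      pointwise : ∀ v → κ v + adj w v + 𝟙 (v Fin.≟ w) ≤ hue j w v + 1
      pointwise v with v Fin.≟ w
      ... | yes refl rewrite adj-ww | 𝟙-no (λ w≢w → w≢w refl) (¬? (w Fin.≟ w)) = ≤-refl
      ... | no v≢w rewrite 𝟙-yes (≢-sym v≢w) (¬? (w Fin.≟ v)) with adj? H w v
      ...   | yes _ = ≤-reflexive (+-identityʳ _)
      ...   | no _  = ≤-trans (≤-reflexive (trans (+-identityʳ _) (trans (+-identityʳ _) (*-identityˡ _)))) (𝟙≤1 (colour c w v ≟ j))
    lemma₁ : ∀ a x d → a + x + suc d ≡ a + suc (d + x)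
    lemma₁ = solve-∀
    lemma₂ : ∀ a n → a + n + n ≡ a + 2 * n
    lemma₂ = solve-∀
    lemma₃ : ∀ a d → a + 2 * suc d ≡ a + d + 1 + suc d
    lemma₃ = solve-∀
    lemma₄ : ∀ a n d → a + n + suc d ≡ a + suc d + n
    lemma₄ = solve-∀

-- The colouring

open ≤-Reasoning

-- The first is A + B for the linear error A n + B that has to stay below n²; the second collects
-- the constant terms of the degree comparison.
capacityThreshold degreeThreshold : ℕ → ℕ → ℕ → ℕ
capacityThreshold s h L = h * (s * s + 2 * L) + 12 * s + 2 * h * s * s * L
degreeThreshold s h L = 312 * s * L + (12 * s * L * (1 + 4 * h) + 12 * h * s)

-- After multiplication by 24s the demand is h n² plus linear terms, while 24sM = 12s(n² - n) is
-- available. As 12s = h + 1, one n² is left over for the linear terms.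
capacity : ∀ {s h L r n M Q b e} .{{_ : NonZero s}} → suc h ≡ 12 * s → L ≡ 24 * r →
           n ≡ e + b * s → e ≤ s → 2 * M + n ≡ n * n → L * Q ≤ (b + e) * (h * (n + 2 * L)) →
           capacityThreshold s h L ≤ n → r * Q ≤ M
capacity {s} {h} {L} {r} {n} {M} {Q} {b} {e} h-eq refl n-eq e≤s M-eq LQ≤ large =
  *-cancelˡ-≤ {r * Q} {M} (24 * s) {{m*n≢0 24 s}} (+-cancelʳ-≤ (12 * s * n) _ _ (begin
    24 * s * (r * Q) + 12 * s * n                                ≡⟨ cong (_+ 12 * s * n) (lemma₁ s r Q) ⟩
    s * (24 * r * Q) + 12 * s * n                                ≤⟨ +-monoˡ-≤ (12 * s * n) (*-monoʳ-≤ s LQ≤) ⟩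
    s * ((b + e) * (h * (n + 2 * L))) + 12 * s * n               ≡⟨ cong (_+ 12 * s * n) (lemma₂ s b e (h * (n + 2 * L))) ⟩
    (b * s + s * e) * (h * (n + 2 * L)) + 12 * s * n             ≤⟨ +-monoˡ-≤ (12 * s * n) (*-monoˡ-≤ (h * (n + 2 * L))
                                                                      (+-mono-≤ (≤-trans (m≤n+m (b * s) e) (≤-reflexive (sym n-eq))) (*-monoʳ-≤ s e≤s))) ⟩
    (n + s * s) * (h * (n + 2 * L)) + 12 * s * n                 ≡⟨ lemma₃ s h L n ⟩
    h * (n * n) + ((h * (s * s + 2 * L) + 12 * s) * n + 2 * h * s * s * L) ≤⟨ +-monoʳ-≤ (h * (n * n)) quadratic ⟩
    h * (n * n) + n * n                                          ≡⟨ +-comm (h * (n * n)) (n * n) ⟩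
    suc h * (n * n)                                              ≡⟨ cong₂ _*_ h-eq (sym M-eq) ⟩
    12 * s * (2 * M + n)                                         ≡⟨ lemma₄ s M n ⟩
    24 * s * M + 12 * s * n                                      ∎))
  where
  lemma₁ : ∀ s r Q → 24 * s * (r * Q) ≡ s * (24 * r * Q)
  lemma₁ = solve-∀
  lemma₂ : ∀ s b e x → s * ((b + e) * x) ≡ (b * s + s * e) * x
  lemma₂ = solve-∀
  lemma₃ : ∀ s h L n → (n + s * s) * (h * (n + 2 * L)) + 12 * s * n ≡
                       h * (n * n) + ((h * (s * s + 2 * L) + 12 * s) * n + 2 * h * s * s * L)
  lemma₃ = solve-∀
  lemma₄ : ∀ s M n → 12 * s * (2 * M + n) ≡ 24 * s * M + 12 * s * n
  lemma₄ = solve-∀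
  A = h * (s * s + 2 * L) + 12 * s
  B = 2 * h * s * s * L
  1≤n : 1 ≤ n
  1≤n = begin
    1              ≤⟨ >-nonZero⁻¹ (12 * s) {{m*n≢0 12 s}} ⟩
    12 * s         ≤⟨ m≤n+m (12 * s) (h * (s * s + 2 * L)) ⟩
    A              ≤⟨ m≤m+n A B ⟩
    A + B          ≤⟨ large ⟩
    n              ∎
  quadratic : A * n + B ≤ n * n
  quadratic = begin
    A * n + B      ≤⟨ +-monoʳ-≤ (A * n) (≤-trans (≤-reflexive (sym (*-identityʳ B))) (*-monoʳ-≤ B 1≤n)) ⟩
    A * n + B * n  ≡⟨ *-distribʳ-+ n A B ⟨
    (A + B) * n    ≤⟨ *-monoˡ-≤ n large ⟩
    n * n          ∎

-- The leading coefficients compare because 12 h (s + 1) exceeds 312 s + s L by 60 + 276 ρ + 120 ρ².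
degree-gap : ∀ ρ {s h L n b e D₁ Dⱼ d} .{{_ : NonZero L}} → s ≡ 2 + ρ → h ≡ 23 + 12 * ρ → L ≡ 24 * (3 + ρ) →
             n ≡ e + b * s → e ≤ s → h * (n + b) ≤ L * (Dⱼ + 1 + 4 * h) → L * D₁ ≤ 26 * (n + L) →
             degreeThreshold s h L ≤ n →
             23 * n + 24 ≤ 24 * d →
             D₁ + 2 * n ≤ Dⱼ + 2 * suc d
degree-gap ρ {s} {h} {L} {n} {b} {e} {D₁} {Dⱼ} {d} refl h-eq L-eq n-eq e≤s own≤ D₁≤ large d-large =
  *-cancelˡ-≤ 12 (begin
    12 * (D₁ + 2 * n)               ≡⟨ lemma₁ D₁ n ⟩
    -- Of the 24n to be paid for, n comes from the surplus n/12 in `majority` and 23n from the large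
    -- degree.
    12 * D₁ + n + 23 * n            ≤⟨ +-mono-≤ majority (≤-trans (m≤m+n (23 * n) 24) d-large) ⟩
    12 * Dⱼ + 24 * d                ≤⟨ m≤m+n _ 24 ⟩
    12 * Dⱼ + 24 * d + 24           ≡⟨ lemma₂ Dⱼ d ⟩
    12 * (Dⱼ + 2 * suc d)           ∎)
  where
  X = 12 * s * L * (1 + 4 * h) + 12 * h * s
  lemma₁ : ∀ D n → 12 * (D + 2 * n) ≡ 12 * D + n + 23 * n
  lemma₁ = solve-∀
  lemma₂ : ∀ D d → 12 * D + 24 * d + 24 ≡ 12 * (D + 2 * suc d)
  lemma₂ = solve-∀
  lemma₃ : ∀ s L D n X → s * L * (12 * D + n) + X ≡ 12 * s * (L * D) + (s * L * n + X)
  lemma₃ = solve-∀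
  lemma₄ : ∀ s L n X → 12 * s * (26 * (n + L)) + (s * L * n + X) ≡ 312 * s * L + X + (312 * s + s * L) * n
  lemma₄ = solve-∀
  -- There is 59 instead of 60 because one spare copy of `n` is reserved for the constant terms,
  -- which `large` bounds by `n`.
  lemma₅ : ∀ ρ n → n + (312 * (2 + ρ) + (2 + ρ) * (24 * (3 + ρ))) * n + (59 + 276 * ρ + 120 * ρ * ρ) * n ≡
                   12 * (23 + 12 * ρ) * ((2 + ρ) * n + n)
  lemma₅ = solve-∀
  lemma₆ : ∀ s h n b → 12 * h * (s * n + (s + b * s)) ≡ 12 * s * (h * (n + b)) + 12 * h * s
  lemma₆ = solve-∀
  lemma₇ : ∀ s h L D → 12 * s * (L * (D + 1 + 4 * h)) + 12 * h * s ≡ s * L * (12 * D) + (12 * s * L * (1 + 4 * h) + 12 * h * s)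
  lemma₇ = solve-∀
  leading : n + (312 * s + s * L) * n ≤ 12 * h * (s * n + n)
  leading = begin
    n + (312 * s + s * L) * n                                           ≡⟨ cong (λ L → n + (312 * s + s * L) * n) L-eq ⟩
    n + (312 * s + s * (24 * (3 + ρ))) * n                              ≤⟨ m≤m+n _ ((59 + 276 * ρ + 120 * ρ * ρ) * n) ⟩
    n + (312 * s + s * (24 * (3 + ρ))) * n + (59 + 276 * ρ + 120 * ρ * ρ) * n ≡⟨ lemma₅ ρ n ⟩
    12 * (23 + 12 * ρ) * (s * n + n)                                    ≡⟨ cong (λ h → 12 * h * (s * n + n)) h-eq ⟨
    12 * h * (s * n + n)                                                ∎
  majority : 12 * D₁ + n ≤ 12 * Dⱼ
  majority = *-cancelˡ-≤ (s * L) {{m*n≢0 s L}} (+-cancelʳ-≤ X _ _ (begin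
    s * L * (12 * D₁ + n) + X                   ≡⟨ lemma₃ s L D₁ n X ⟩
    12 * s * (L * D₁) + (s * L * n + X)         ≤⟨ +-monoˡ-≤ (s * L * n + X) (*-monoʳ-≤ (12 * s) D₁≤) ⟩
    12 * s * (26 * (n + L)) + (s * L * n + X)   ≡⟨ lemma₄ s L n X ⟩
    312 * s * L + X + (312 * s + s * L) * n     ≤⟨ +-monoˡ-≤ ((312 * s + s * L) * n) large ⟩
    n + (312 * s + s * L) * n                   ≤⟨ leading ⟩
    12 * h * (s * n + n)                        ≤⟨ *-monoʳ-≤ (12 * h) (+-monoʳ-≤ (s * n) (≤-trans (≤-reflexive n-eq) (+-monoˡ-≤ (b * s) e≤s))) ⟩
    12 * h * (s * n + (s + b * s))              ≡⟨ lemma₆ s h n b ⟩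
    12 * s * (h * (n + b)) + 12 * h * s         ≤⟨ +-monoˡ-≤ (12 * h * s) (*-monoʳ-≤ (12 * s) own≤) ⟩
    12 * s * (L * (Dⱼ + 1 + 4 * h)) + 12 * h * s ≡⟨ lemma₇ s h L Dⱼ ⟩
    s * L * (12 * Dⱼ) + X                       ∎))

∣-∣≤1 : ∀ {q x y} → q ≤ x × x ≤ suc q → q ≤ y × y ≤ suc q → ∣ x - y ∣ ≤ 1
∣-∣≤1 {q} {x} {y} (q≤x , x≤) (q≤y , y≤) with ≤-total x y
... | inj₁ x≤y = begin
  ∣ x - y ∣   ≡⟨ m≤n⇒∣m-n∣≡n∸m x≤y ⟩
  y ∸ x       ≤⟨ ∸-mono y≤ q≤x ⟩
  suc q ∸ q   ≡⟨ m+n∸n≡m 1 q ⟩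
  1           ∎
  where open ≤-Reasoning
... | inj₂ y≤x = begin
  ∣ x - y ∣   ≡⟨ m≤n⇒∣n-m∣≡n∸m y≤x ⟩
  x ∸ y       ≤⟨ ∸-mono x≤ q≤y ⟩
  suc q ∸ q   ≡⟨ m+n∸n≡m 1 q ⟩
  1           ∎
  where open ≤-Reasoning

colour⇒Fin : ∀ {r i} → 1 ≤ i → i ≤ r → Σ[ k ∈ Fin r ] i ≡ suc (toℕ k)
colour⇒Fin {i = suc i} _ i<r = fromℕ< i<r , cong suc (sym (Fin.toℕ-fromℕ< i<r))

-- Colourings from functions on ordered pairs

module _ {n r : ℕ} (f : Fin n × Fin n → Fin r) where

  -- The counts of `f` are controlled only on pairs listed in increasing order, so every edge looks
  -- up its colour there.
  sort : Fin n → Fin n → Fin n × Fin n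
  sort u v with u Fin.<? v
  ... | yes _ = u , v
  ... | no _  = v , u

  sort-< : ∀ {u v} → toℕ u < toℕ v → sort u v ≡ (u , v)
  sort-< {u} {v} u<v with u Fin.<? v
  ... | yes _  = refl
  ... | no u≮v = contradiction u<v u≮v

  sort-> : ∀ {u v} → toℕ v < toℕ u → sort u v ≡ (v , u)
  sort-> {u} {v} v<u with u Fin.<? v
  ... | yes u<v = contradiction v<u (<-asym u<v)
  ... | no _    = refl

  sort-comm : ∀ u v → u ≢ v → sort u v ≡ sort v u
  sort-comm u v u≢v with Fin.<-cmp u v
  ... | tri< u<v _ _ = trans (sort-< u<v) (sym (sort-> u<v))
  ... | tri≈ _ u≡v _ = contradiction u≡v u≢v
  ... | tri> _ _ v<u = trans (sort-> v<u) (sym (sort-< v<u))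

  colouring : EdgeColouring (K n) r
  colouring = record
    { colour     = λ u v → suc (toℕ (f (sort u v)))
    ; colour-sym = λ u v u≢v → cong (suc ∘ toℕ ∘ f) (sort-comm u v u≢v)
    ; in-range   = λ u v _ → s≤s z≤n , Fin.toℕ<n (f (sort u v))
    }

  colouring-count : ∀ k → colourCount colouring (K n) (suc (toℕ k)) ≡ sumₗ (λ e → 𝟙 (f e Fin.≟ k)) (edges (K n))
  colouring-count k = trans (colourCount-sum colouring (K n) (suc (toℕ k))) (trans
    (∑∑-cong same) (sym (sumₗ-edges (K n) (λ e → 𝟙 (f e Fin.≟ k)))))
    where
    same : ∀ u v → 𝟙 (u Fin.<? v) * (𝟙 (adj? (K n) u v) * 𝟙 (suc (toℕ (f (sort u v))) ≟ suc (toℕ k))) ≡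
                   𝟙 (u Fin.<? v) * (𝟙 (adj? (K n) u v) * 𝟙 (f (u , v) Fin.≟ k))
    same u v with u Fin.<? v
    ... | yes _ = cong (λ x → 1 * (𝟙 (adj? (K n) u v) * x))
      (𝟙-cong (Fin.toℕ-injective ∘ suc-injective) (cong (suc ∘ toℕ)) (suc (toℕ (f (u , v))) ≟ suc (toℕ k)) (f (u , v) Fin.≟ k))
    ... | no _  = refl

  colouring-balanced : ∀ {q} (t : Fin r → ℕ) → (∀ k → q ≤ t k × t k ≤ suc q) →
                       (∀ k → sumₗ (λ e → 𝟙 (f e Fin.≟ k)) (edges (K n)) ≡ t k) → Balanced colouring
  colouring-balanced t bounds counts i j 1≤i i≤r 1≤j j≤r with colour⇒Fin 1≤i i≤r | colour⇒Fin 1≤j j≤r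
  ... | k , refl | l , refl = subst₂ (λ x y → ∣ x - y ∣ ≤ 1)
    (sym (trans (colouring-count k) (counts k))) (sym (trans (colouring-count l) (counts l)))
    (∣-∣≤1 (bounds k) (bounds l))

-- There are s = r − 1 blocks; s and h are kept as variables so that numerals such as 23 + 12 * ρ never unfold.
module Construction (ρ n s h : ℕ) (s-eq : s ≡ 2 + ρ) (h-eq : h ≡ 23 + 12 * ρ)
                    (large₁ : capacityThreshold s h (period h) ≤ n) (large₂ : degreeThreshold s h (period h) ≤ n) where

  instance
    s≢0 : NonZero s
    s≢0 = subst NonZero (sym s-eq) _

  b e : ℕ
  b = n / s
  e = n % s

  L-eq : period h ≡ 24 * (3 + ρ)
  L-eq = trans (cong period h-eq) (lemma ρ)
    where
    lemma : ∀ ρ → 26 + (23 + 12 * ρ) * 2 ≡ 24 * (3 + ρ)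
    lemma = solve-∀

  1+h≡12s : suc h ≡ 12 * s
  1+h≡12s = trans (cong suc h-eq) (trans (lemma ρ) (cong (12 *_) (sym s-eq)))
    where
    lemma : ∀ ρ → 24 + 12 * ρ ≡ 12 * (2 + ρ)
    lemma = solve-∀

  n-eq : n ≡ e + b * s
  n-eq = m≡m%n+[m/n]*n n s

  e≤s : e ≤ s
  e≤s = <⇒≤ (m%n<n n s)

  open Wish h b (suc ρ)
  open Extension {A = Fin n × Fin n} (≡-dec Fin._≟_ Fin._≟_) {suc (suc ρ)} using (demand; used; Extends; extend)

  E : List (Fin n × Fin n)
  E = edges (K n)

  targets = balancedParts (length E) (3 + ρ)
  target = proj₁ targets

  -- Colour 1 is never demanded. For the others `capacity` bounds r times the demand by the number
  -- of edges, hence the demand by the rounded-down share, which no target undercuts.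
  fits : ∀ k → demand pairWish k E ≤ target k
  fits zero    = ≤-trans (≤-reflexive (trans
    (sumₗ-cong (λ (u , v) → 𝟙-no (wish≢zero (toℕ u) (toℕ v)) (pairWish (u , v) ≟ₘ just zero)) E) (sumₗ-zero E))) z≤n
    where
    sumₗ-zero : ∀ xs → sumₗ {A = Fin n × Fin n} (λ _ → 0) xs ≡ 0
    sumₗ-zero []       = refl
    sumₗ-zero (x ∷ xs) = sumₗ-zero xs
  fits (suc c) = begin
    demand pairWish (suc c) E                          ≡⟨ sumₗ-edges (K n) (λ x → 𝟙 (pairWish x ≟ₘ just (suc c))) ⟩
    ∑< (λ u v → 𝟙 (adj? (K n) u v) * w u v)            ≤⟨ ∑∑-mono (λ u v → *-monoʳ-≤ (𝟙 (u Fin.<? v))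
      (≤-trans (*-monoˡ-≤ (w u v) (𝟙≤1 (adj? (K n) u v))) (≤-reflexive (*-identityˡ (w u v))))) ⟩
    ∑< w                                               ≡⟨ m*n/n≡m (∑< w) (3 + ρ) ⟨
    ∑< w * (3 + ρ) / (3 + ρ)                           ≤⟨ /-monoˡ-≤ (3 + ρ) (≤-trans (≤-reflexive (*-comm (∑< w) (3 + ρ)))
      (capacity {s} {h} {period h} {3 + ρ} {n} {length E} {∑< w} {b} {e} 1+h≡12s L-eq n-eq e≤s (length-edges-K {n})
        (pairWish-count {n} e c (≤-reflexive (trans n-eq (trans (+-comm e (b * s)) (cong (_+ e) (trans (*-comm b s) (cong (_* b) s-eq)))))))
        large₁)) ⟩
    length E / (3 + ρ)                                 ≤⟨ proj₁ (proj₂ (proj₂ targets) (suc c)) ⟩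
    target (suc c)                                     ∎
    where
    open ≤-Reasoning
    w : Fin n → Fin n → ℕ
    w u v = 𝟙 (pairWish (u , v) ≟ₘ just (suc c))

  extension : Σ[ f ∈ (Fin n × Fin n → Fin (3 + ρ)) ] (Extends pairWish f × (∀ k → used f k E ≡ target k))
  extension = extend pairWish E (edges-unique (K n)) target (proj₁ (proj₂ targets)) fits

  balanced : Balanced (colouring (proj₁ extension))
  balanced = colouring-balanced (proj₁ extension) target (proj₂ (proj₂ targets)) (proj₂ (proj₂ extension))

  module Majority (f : Fin n × Fin n → Fin (3 + ρ)) (extends : Extends pairWish f) where

    γ : EdgeColouring (K n) (3 + ρ)
    γ = colouring f

    colour-wish : ∀ u v k → wish (toℕ u) (toℕ v) ≡ just k → colour γ u v ≡ suc (toℕ k)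
    colour-wish u v k eq with u Fin.<? v
    ... | yes _ = cong (suc ∘ toℕ) (extends (u , v) k eq)
    ... | no _  = cong (suc ∘ toℕ) (extends (v , u) k (trans (wish-comm (toℕ v) (toℕ u)) eq))

    favourite : Fin n → ℕ
    favourite w = suc (toℕ (Fin.suc (block b (suc ρ) (toℕ w))))

    -- On every pair that is not spare the demand is met, and no demand asks for colour 1.
    colourDegree-1 : ∀ w → colourDegree γ w 1 ≤ sum< n (λ v → isSpare (kind h (toℕ w + v)))
    colourDegree-1 w = ≤-trans
      (sum-mono {n} (λ v → ≤-trans (≤-trans (*-monoˡ-≤ _ (𝟙≤1 (¬? (w Fin.≟ v)))) (≤-reflexive (*-identityˡ _))) (pointwise v)))
      (≤-reflexive (sum-toℕ n (λ v → isSpare (kind h (toℕ w + v)))))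
      where
      not-1 : ∀ v c {x} → wish (toℕ w) (toℕ v) ≡ just (suc c) → 𝟙 (colour γ w v ≟ 1) ≤ x
      not-1 v c eq = ≤-trans (≤-reflexive (𝟙-no
        (λ is-1 → contradiction (suc-injective (trans (sym (colour-wish w v (suc c) eq)) is-1)) λ ())
        (colour γ w v ≟ 1))) z≤n
      pointwise : ∀ v → 𝟙 (colour γ w v ≟ 1) ≤ isSpare (kind h (toℕ w + toℕ v))
      pointwise v with kind h (toℕ w + toℕ v) in eq
      ... | first  = not-1 v _ (cong (λ κ → owner κ (toℕ w) (toℕ v)) eq)
      ... | second = not-1 v _ (cong (λ κ → owner κ (toℕ w) (toℕ v)) eq)
      ... | spare  = 𝟙≤1 (colour γ w v ≟ 1)

    -- The extra 1 pays for v = w, which is no edge but is not excluded from `ownDegreeBound`.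
    colourDegree-favourite : ∀ w → sum< n (ownDegreeBound (toℕ w)) ≤ colourDegree γ w (favourite w) + 1
    colourDegree-favourite w = begin
      sum< n (ownDegreeBound (toℕ w))                            ≡⟨ sum-toℕ n (ownDegreeBound (toℕ w)) ⟨
      sum {n} (ownDegreeBound (toℕ w) ∘ toℕ)                     ≤⟨ sum-mono {n} pointwise ⟩
      sum {n} (λ v → κ v + 𝟙 (v Fin.≟ w))                        ≡⟨ ∑-distrib-+ {n} κ (λ v → 𝟙 (v Fin.≟ w)) ⟩
      sum κ + sum (λ v → 𝟙 (v Fin.≟ w))                          ≡⟨ cong (sum κ +_) (sum-≡₁ w) ⟩
      sum κ + 1                                                  ∎
      where
      open ≤-Reasoning
      κ : Fin n → ℕ
      κ v = 𝟙 (¬? (w Fin.≟ v)) * 𝟙 (colour γ w v ≟ favourite w)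
      pointwise : ∀ v → ownDegreeBound (toℕ w) (toℕ v) ≤ κ v + 𝟙 (v Fin.≟ w)
      pointwise v with v Fin.≟ w
      ... | yes _  = ≤-trans (ownDegreeBound-≤ (toℕ w) (toℕ v)) (≤-trans (𝟙≤1 (wish (toℕ w) (toℕ v) ≟ₘ _)) (m≤n+m 1 (κ v)))
      ... | no v≢w = begin
        ownDegreeBound (toℕ w) (toℕ v)                           ≤⟨ ownDegreeBound-≤ (toℕ w) (toℕ v) ⟩
        𝟙 (wish (toℕ w) (toℕ v) ≟ₘ just (suc c))                 ≤⟨ 𝟙-mono (colour-wish w v (suc c)) _ (colour γ w v ≟ favourite w) ⟩
        𝟙 (colour γ w v ≟ favourite w)                           ≡⟨ *-identityˡ _ ⟨
        1 * 𝟙 (colour γ w v ≟ favourite w)                       ≡⟨ cong (_* 𝟙 (colour γ w v ≟ favourite w)) (𝟙-yes (≢-sym v≢w) (¬? (w Fin.≟ v))) ⟨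
        κ v                                                      ≡⟨ +-identityʳ (κ v) ⟨
        κ v + 0                                                  ∎
        where c = block b (suc ρ) (toℕ w)

    dominated : (H : Graph n) → ¬ Cycle H → ∀ w → 23 * n + 24 ≤ 24 * degree H w →
                colourCount γ H 1 ≤ colourCount γ H (favourite w)
    dominated H acyclic w d-large = colourCount-≤ γ H acyclic w 1 (favourite w)
      (degree-gap ρ {s} {h} {period h} {n} {b} {e} {colourDegree γ w 1} {colourDegree γ w (favourite w)} {degree H w} s-eq h-eq L-eq n-eq e≤s
        (≤-trans (ownDegreeBound-sum n (toℕ w) (≤-trans (≤-reflexive (trans (cong (_* b) (sym s-eq)) (*-comm s b))) (m/n*n≤m n s)))
                 (*-monoʳ-≤ (period h) (+-monoˡ-≤ (4 * h) (colourDegree-favourite w))))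
        (≤-trans (*-monoʳ-≤ (period h) (colourDegree-1 w)) (spare-sum n (toℕ w)))
        large₂
        d-large)

proposition1p4 : ∃[ C ] (0 < C × (∀ (r : ℕ) → r ≥ 3 →
      ∃[ N ] (∀ (n : ℕ) → n ≥ N →
        Σ[ c ∈ EdgeColouring (K n) r ] (Balanced c ×
          (∀ (T : Graph n) → IsTree T →
            24 * maxDegree T ≥ 23 * n + 24 * C →
            (H : Copy T (K n)) →
            ∃[ j ] (2 ≤ j × j ≤ r ×
              colourCount c (Copy.graph H) 1 ≤ colourCount c (Copy.graph H) j))))))
proposition1p4 = 1 , z<s , λ { (suc (suc (suc ρ))) (s≤s (s≤s (s≤s z≤n))) →
    let s = 2 + ρ
        h = 23 + 12 * ρ
        N₁ = capacityThreshold s h (period h)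
        N₂ = degreeThreshold s h (period h)
    in N₁ + N₂ , λ n n≥N →
    let open Construction ρ n s h refl refl (≤-trans (m≤m+n N₁ N₂) n≥N) (≤-trans (m≤n+m N₂ N₁) n≥N) in
    let open Majority (proj₁ extension) (proj₁ (proj₂ extension)) in
    γ , balanced , λ T ((r , _) , acyclic) Δ-large H →
      let (v , Δ≤) = maxDegree-attained T r
          -- Colours are counted in the copy, so the vertex of maximum degree is carried there from
          -- `T`.
          w        = proj₁ (Copy.iso H) ⟨$⟩ʳ v
          d-large  = ≤-trans Δ-large (*-monoʳ-≤ 24 (≤-trans Δ≤ (≤-reflexive (iso-degree T (Copy.graph H) (Copy.iso H) v))))
      in favourite w , s≤s (s≤s z≤n) , Fin.toℕ<n (Fin.suc (block b (suc ρ) (toℕ w))) ,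
         dominated (Copy.graph H) (acyclic ∘ iso-cycle T (Copy.graph H) (Copy.iso H)) w d-large }
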